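{- Let $k\ge 2$ and let $$P(t)=1+\sum_{n\ge1}\frac{p^{\binom n2}(-t)^n}{[n]_{p,q}!}[k]_{r^n},\quad G(t)=\sum_{n\ge2}(n-1)\frac{p^{\binom n2}(-t)^n}{[n]_{p,q}!}[k]_{r^n},\quad H(t)=-\sum_{n\ge3}\binom{n-1}{2}\frac{p^{\binom n2}(-t)^n}{[n]_{p,q}!}[k]_{r^n}.$$ Then $$\sum_{n\ge0}\frac{t^n}{[n]_{p,q}!}\sum_{(\sigma,w)\in\mathcal{U}_{n,k}}q^{\mathrm{inv}(\sigma)}p^{\mathrm{coinv}(\sigma)}r^{\|w\|}=\frac{([k]_rt-1)+P(t)-G(t)}{P(t)^2}$$ and $$\sum_{n\ge0}\frac{t^n}{[n]_{p,q}!}\sum_{(\sigma,w)\in\mathcal{V}_{n,k}}q^{\mathrm{inv}(\sigma)}p^{\mathrm{coinv}(\sigma)}r^{\|w\|}=\frac{G(t)^2+P(t)\big(H(t)+G(t)-([k]_rt-1)-P(t)\big)}{P(t)^3}.$$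
   Context: $C_k\wr S_n$ is identified with the set of pairs $(\sigma,w)$, $\sigma\in S_n$, $w=w_1\cdots w_n\in\{0,\dots,k-1\}^n$. The weak rise set is $\mathrm{WRis}(\sigma,w)=\{i\le n-1:\sigma_i<\sigma_{i+1},\ w_i= w_{i+1}\}$. $\mathcal{U}_{n,k}$ is the set of $(\sigma,w)\in C_k\wr S_n$ with $\mathrm{WRis}(\sigma,w)=\{s,s+1\}$ for some $1\le s\le n-2$; $\mathcal{V}_{n,k}$ is the set of $(\sigma,w)\in C_k\wr S_n$ with $\mathrm{WRis}(\sigma,w)=\{i,j\}$ for some $i+2\le j$. $\mathrm{inv}(\sigma)=|\{a<b:\sigma_a>\sigma_b\}|$, $\mathrm{coinv}(\sigma)=|\{a<b:\sigma_a<\sigma_b\}|$, $\|w\|=w_1+\cdots+w_n$. $[n]_{p,q}=p^{n-1}+\cdots+q^{n-1}$, $[n]_{p,q}!=[n]_{p,q}\cdots[1]_{p,q}$; $[k]_r=1+r+\cdots+r^{k-1}$, $[k]_{r^n}=1+r^n+\cdots+r^{(k-1)n}$. -}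

module Defs where

open import Level using (Level)
open import Data.Bool using (Bool; true; false; _∧_; if_then_else_)
open import Data.Nat using (ℕ; zero; suc; _∸_; _<ᵇ_; _≡ᵇ_; _≤ᵇ_)
open import Data.Nat.Combinatorics using (_C_)
open import Data.List using (List; []; _∷_; map; concatMap; filterᵇ; length; foldr; upTo)
open import Data.Nat.ListAction using (sum)
open import Data.Product using (_×_; _,_)
open import Algebra.Bundles using (CommutativeRing)
import Relation.Binary.PropositionalEquality as Eq

insertions : ℕ → List ℕ → List (List ℕ)
insertions x []       = (x ∷ []) ∷ []
insertions x (y ∷ ys) = (x ∷ y ∷ ys) ∷ map (y ∷_) (insertions x ys)

perms : ℕ → List (List ℕ)
perms zero    = [] ∷ []
perms (suc n) = concatMap (insertions (suc n)) (perms n)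

words : ℕ → ℕ → List (List ℕ)
words k zero    = [] ∷ []
words k (suc n) = concatMap (λ w → map (_∷ w) (upTo k)) (words k n)

-- the elements of C_k ≀ S_n as pairs (σ , w)
wreath : ℕ → ℕ → List (List ℕ × List ℕ)
wreath n k = concatMap (λ σ → map (σ ,_) (words k n)) (perms n)

inv : List ℕ → ℕ
inv []       = 0
inv (x ∷ xs) = length (filterᵇ (λ y → y <ᵇ x) xs) Data.Nat.+ inv xs

coinv : List ℕ → ℕ
coinv []       = 0
coinv (x ∷ xs) = length (filterᵇ (λ y → x <ᵇ y) xs) Data.Nat.+ coinv xs

-- WRis(σ,w), listed increasingly; positions are 1-indexed, i ≤ n-1,
-- i ∈ WRis iff σ_i < σ_{i+1} and w_i = w_{i+1}.
-- The first argument is the 1-based index of the head.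
wrisFrom : ℕ → List ℕ → List ℕ → List ℕ
wrisFrom i (a ∷ b ∷ σ) (u ∷ v ∷ w) =
  if (a <ᵇ b) ∧ (u ≡ᵇ v) then i ∷ wrisFrom (suc i) (b ∷ σ) (v ∷ w)
                          else wrisFrom (suc i) (b ∷ σ) (v ∷ w)
wrisFrom i _ _ = []

WRis : List ℕ × List ℕ → List ℕ
WRis (σ , w) = wrisFrom 1 σ w

-- WRis = {s, s+1}  (1 ≤ s ≤ n-2 is automatic for positions of WRis)
isU : List ℕ → Bool
isU (a ∷ b ∷ []) = b ≡ᵇ suc a
isU _            = false

isV : List ℕ → Bool
isV (a ∷ b ∷ []) = suc (suc a) ≤ᵇ b
isV _            = false

𝒰 : ℕ → ℕ → List (List ℕ × List ℕ)
𝒰 n k = filterᵇ (λ x → isU (WRis x)) (wreath n k)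

𝒱 : ℕ → ℕ → List (List ℕ × List ℕ)
𝒱 n k = filterᵇ (λ x → isV (WRis x)) (wreath n k)

module WithRing {c ℓ : Level} (R : CommutativeRing c ℓ) where
  open CommutativeRing R

  infixr 8 _^'_
  _^'_ : Carrier → ℕ → Carrier
  x ^' zero  = 1#
  x ^' suc n = x * (x ^' n)

  natMul : ℕ → Carrier → Carrier
  natMul zero    x = 0#
  natMul (suc n) x = x + natMul n x

  sumBelow : ℕ → (ℕ → Carrier) → Carrier
  sumBelow zero    f = 0#
  sumBelow (suc n) f = sumBelow n f + f n

  pqInt : Carrier → Carrier → ℕ → Carrier
  pqInt p q n = sumBelow n (λ i → (p ^' (n ∸ 1 ∸ i)) * (q ^' i))

  pqFact : Carrier → Carrier → ℕ → Carrier
  pqFact p q zero    = 1#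
  pqFact p q (suc n) = pqInt p q (suc n) * pqFact p q n

  kInt : ℕ → Carrier → Carrier
  kInt k x = sumBelow k (λ i → x ^' i)

  Series : Set c
  Series = ℕ → Carrier

  _⊕_ : Series → Series → Series
  (f ⊕ g) n = f n + g n

  _⊖_ : Series → Series → Series
  (f ⊖ g) n = f n - g n

  _⊛_ : Series → Series → Series
  (f ⊛ g) n = sumBelow (suc n) (λ i → f i * g (n ∸ i))

  infixl 6 _⊕_ _⊖_
  infixl 7 _⊛_
  infix 4 _≋_

  _≋_ : Series → Series → Set ℓ
  f ≋ g = ∀ n → f n ≈ g n

  weightSum : Carrier → Carrier → Carrier → List (List ℕ × List ℕ) → Carrier
  weightSum p q r = foldr (λ { (σ , w) acc → (q ^' inv σ) * (p ^' coinv σ) * (r ^' sum w) + acc }) 0#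

  module GF (k : ℕ) (p q r : Carrier) (invFact : ℕ → Carrier) where
    -- invFact n plays the role of 1/[n]_{p,q}!

    e : ℕ → Carrier
    e n = (p ^' (n C 2)) * ((- 1#) ^' n) * invFact n * kInt k (r ^' n)

    P : Series
    P zero    = 1#
    P (suc n) = e (suc n)

    G : Series
    G n = natMul (n ∸ 1) (e n)

    H : Series
    H n = - natMul ((n ∸ 1) C 2) (e n)

    L : Series
    L zero          = - 1#
    L (suc zero)    = kInt k r
    L (suc (suc n)) = 0#

    AU : Series
    AU n = invFact n * weightSum p q r (𝒰 n k)

    AV : Series
    AV n = invFact n * weightSum p q r (𝒱 n k)

{-# OPTIONS --safe #-}

-- The weight of (σ , w) is computed letter by letter: splitting off the first letter of σ shows
-- that a block of l letters with increasing σ and constant w, followed by an arbitrary element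
-- of C_k ≀ S_m, contributes p^(l C 2) [k]_{r^l} times a p,q-binomial coefficient (the weight of
-- the increasing Lehmer codes) times the sum over C_k ≀ S_m. Hence multiplying a generating
-- function Σ tⁿ/[n]! Σ weight · Φ(rise pattern) by P, G or H acts on Φ alone, by prepending a
-- block of rises with a free position behind it. With N_j the generating function of exactly j
-- weak rises, the recursions P N₀ = 1, P N₁ = G N₀, P N₂ = G N₁ + H N₀ and
-- P U = ([k]_r t − 1 + P − G) N₀ thereby become identities between functions of bit lists,
-- proved by induction, and U + V = N₂ gives both formulas.

module Submission where

open import Defs
open import Level using (Level)
open import Data.Bool using (Bool; true; false; _∧_; if_then_else_)
open import Data.Nat as ℕ using (ℕ; zero; suc; _∸_; _≤_; _<_; z≤n; s≤s; _<ᵇ_; _≡ᵇ_)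
import Data.Nat.Properties as ℕ
open import Data.Nat.Combinatorics using (_C_; nCk+nC[k+1]≡[n+1]C[k+1]; nC1≡n)
open import Data.Nat.ListAction using (sum)
open import Data.List using (List; []; _∷_; _++_; map; concatMap; filterᵇ; length; applyDownFrom; applyUpTo; upTo)
open import Data.List.Properties using (map-∘; map-upTo; length-applyDownFrom)
open import Data.List.Relation.Unary.All as All using (All; []; _∷_)
import Data.List.Relation.Unary.All.Properties as All
open import Data.List.Relation.Binary.Permutation.Propositional using (_↭_; ↭-refl; ↭-trans; ↭-sym; prep; swap)
open import Data.List.Relation.Binary.Permutation.Propositional.Properties using (↭-length; All-resp-↭)
open import Data.Product using (_×_; _,_; proj₁)
open import Data.Sum using (inj₁; inj₂)
open import Algebra.Bundles using (CommutativeRing)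
import Algebra.Construct.Pointwise ℕ as Pointwise
open import Relation.Binary.PropositionalEquality as ≡ using (_≡_; cong; cong₂; module ≡-Reasoning)

-- Two mismatches shape the proof. `perms` inserts the largest letter anywhere, while rises are read
-- from the left; so every sum over permutations is reorganised by the first letter, whose rank is a
-- Lehmer digit. And the junction behind a block may or may not be a rise: instead of deciding it,
-- the function on bit lists discards that bit, which leaves the word behind the block completely
-- free and lets its sum factor out. All identities on bit lists follow one scheme. Peeling off a
-- bit shifts the coefficient sequence by one; adding the induction hypothesis to the goal brings in
-- the unshifted sequence; as the signs alternate, the two together form a finite difference. Up to
-- sign the coefficients of P, G, H carry C(n-1,0), C(n-1,1), C(n-1,2), so each difference falls
-- back on the preceding sequence. Additive cancellation stands in for subtraction because the
-- solver works over commutative semirings.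

-- Counting letters, and permutations as rearrangements of n, ..., 1.

count : (ℕ → Bool) → List ℕ → ℕ
count p xs = length (filterᵇ p xs)

count-∷ : ∀ p x xs → count p (x ∷ xs) ≡ (if p x then 1 else 0) ℕ.+ count p xs
count-∷ p x xs with p x
... | true  = ≡.refl
... | false = ≡.refl

count-cong : ∀ {p q} → (∀ x → p x ≡ q x) → ∀ xs → count p xs ≡ count q xs
count-cong h [] = ≡.refl
count-cong {p} {q} h (x ∷ xs)
  rewrite count-∷ p x xs | count-∷ q x xs | h x = cong (_ ℕ.+_) (count-cong h xs)

count-map : ∀ p (f : ℕ → ℕ) xs → count p (map f xs) ≡ count (λ x → p (f x)) xs
count-map p f [] = ≡.refl
count-map p f (x ∷ xs)
  rewrite count-∷ p (f x) (map f xs) | count-∷ (λ y → p (f y)) x xs = cong (_ ℕ.+_) (count-map p f xs)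

count-↭ : ∀ p {xs ys} → xs ↭ ys → count p xs ≡ count p ys
count-↭ p _↭_.refl = ≡.refl
count-↭ p (prep {xs} {ys} x h)
  rewrite count-∷ p x xs | count-∷ p x ys = cong (_ ℕ.+_) (count-↭ p h)
count-↭ p (swap {xs} {ys} x y h)
  rewrite count-∷ p x (y ∷ xs) | count-∷ p y xs | count-∷ p y (x ∷ ys) | count-∷ p x ys
        | count-↭ p h with p x | p y
... | true  | true  = ≡.refl
... | true  | false = ≡.refl
... | false | true  = ≡.refl
... | false | false = ≡.refl
count-↭ p (_↭_.trans h h′) = ≡.trans (count-↭ p h) (count-↭ p h′)

insertions-↭ : ∀ x ys → All (_↭ x ∷ ys) (insertions x ys)
insertions-↭ x []       = ↭-refl ∷ []
insertions-↭ x (y ∷ ys) =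
  ↭-refl ∷ All.map⁺ (All.map (λ h → ↭-trans (prep y h) (swap y x ↭-refl)) (insertions-↭ x ys))

perms-↭ : ∀ n → All (_↭ applyDownFrom suc n) (perms n)
perms-↭ zero    = ↭-refl ∷ []
perms-↭ (suc n) = All.concat⁺ (All.map⁺ (All.map
  (λ {σ} h → All.map (λ h′ → ↭-trans h′ (prep (suc n) h)) (insertions-↭ (suc n) σ)) (perms-↭ n)))

-- Relabelling behind a first letter: inversions and coinversions.

-- The increasing bijection from ℕ onto ℕ ∖ {i}.
skip : ℕ → ℕ → ℕ
skip zero    x       = suc x
skip (suc i) zero    = zero
skip (suc i) (suc x) = suc (skip i x)

skip-≥ : ∀ {i x} → i ≤ x → skip i x ≡ suc x
skip-≥ z≤n     = ≡.refl
skip-≥ (s≤s h) = cong suc (skip-≥ h)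

skip-< : ∀ {i x} → x < i → skip i x ≡ x
skip-< {suc i} {zero}  h       = ≡.refl
skip-< {suc i} {suc x} (s≤s h) = cong suc (skip-< h)

skip-<ᵇ-skip : ∀ i x y → (skip i x <ᵇ skip i y) ≡ (x <ᵇ y)
skip-<ᵇ-skip zero    x       y       = ≡.refl
skip-<ᵇ-skip (suc i) zero    zero    = ≡.refl
skip-<ᵇ-skip (suc i) zero    (suc y) = ≡.refl
skip-<ᵇ-skip (suc i) (suc x) zero    = ≡.refl
skip-<ᵇ-skip (suc i) (suc x) (suc y) = skip-<ᵇ-skip i x y

skip-<ᵇ : ∀ i x → (skip i x <ᵇ i) ≡ (x <ᵇ i)
skip-<ᵇ zero    x       = ≡.refl
skip-<ᵇ (suc i) zero    = ≡.refl
skip-<ᵇ (suc i) (suc x) = skip-<ᵇ i x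

<ᵇ-skip : ∀ i x → (i <ᵇ skip i x) ≡ (i <ᵇ suc x)
<ᵇ-skip zero    x       = ≡.refl
<ᵇ-skip (suc i) zero    = ≡.refl
<ᵇ-skip (suc i) (suc x) = <ᵇ-skip i x

map-skip-id : ∀ {i xs} → All (_< i) xs → map (skip i) xs ≡ xs
map-skip-id []      = ≡.refl
map-skip-id (h ∷ k) = cong₂ _∷_ (skip-< h) (map-skip-id k)

insertions-map : ∀ (f : ℕ → ℕ) x ys → insertions (f x) (map f ys) ≡ map (map f) (insertions x ys)
insertions-map f x []       = ≡.refl
insertions-map f x (y ∷ ys) = cong ((f x ∷ f y ∷ map f ys) ∷_)
  (≡.trans (cong (map (f y ∷_)) (insertions-map f x ys))
           (≡.trans (≡.sym (map-∘ (insertions x ys))) (map-∘ (insertions x ys))))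

inv-map-skip : ∀ i xs → inv (map (skip i) xs) ≡ inv xs
inv-map-skip i []       = ≡.refl
inv-map-skip i (x ∷ xs) = cong₂ ℕ._+_
  (≡.trans (count-map _ (skip i) xs) (count-cong (λ y → skip-<ᵇ-skip i y x) xs)) (inv-map-skip i xs)

coinv-map-skip : ∀ i xs → coinv (map (skip i) xs) ≡ coinv xs
coinv-map-skip i []       = ≡.refl
coinv-map-skip i (x ∷ xs) = cong₂ ℕ._+_
  (≡.trans (count-map _ (skip i) xs) (count-cong (λ y → skip-<ᵇ-skip i x y) xs)) (coinv-map-skip i xs)

down-< : ∀ n → All (_< suc n) (applyDownFrom suc n)
down-< zero    = []
down-< (suc n) = ℕ.≤-refl ∷ All.map ℕ.m≤n⇒m≤1+n (down-< n)

≤⇒≮ᵇ : ∀ {m n} → m ≤ n → (n <ᵇ m) ≡ false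
≤⇒≮ᵇ z≤n     = ≡.refl
≤⇒≮ᵇ (s≤s h) = ≤⇒≮ᵇ h

<⇒<ᵇ≡true : ∀ {m n} → m < n → (m <ᵇ n) ≡ true
<⇒<ᵇ≡true {zero}  {suc n} h       = ≡.refl
<⇒<ᵇ≡true {suc m} {suc n} (s≤s h) = <⇒<ᵇ≡true h

count-≤-down-all : ∀ {c} n → n ≤ c → count (_<ᵇ suc c) (applyDownFrom suc n) ≡ n
count-≤-down-all zero    h = ≡.refl
count-≤-down-all {c} (suc n) h
  rewrite count-∷ (_<ᵇ suc c) (suc n) (applyDownFrom suc n) | <⇒<ᵇ≡true h =
  cong suc (count-≤-down-all n (ℕ.≤-trans (ℕ.n≤1+n n) h))

count-≤-down : ∀ {c n} → c ≤ n → count (_<ᵇ suc c) (applyDownFrom suc n) ≡ c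
count-≤-down {c} {n} h with ℕ.m≤n⇒m<n∨m≡n h
... | inj₂ ≡.refl = count-≤-down-all n ℕ.≤-refl
... | inj₁ (s≤s {n = n′} h′)
  rewrite count-∷ (_<ᵇ suc c) (suc n′) (applyDownFrom suc n′) | ≤⇒≮ᵇ h′ = count-≤-down h′

count->-down-all : ∀ {c} n → n ≤ c → count (c <ᵇ_) (applyDownFrom suc n) ≡ 0
count->-down-all zero    h = ≡.refl
count->-down-all {c} (suc n) h
  rewrite count-∷ (c <ᵇ_) (suc n) (applyDownFrom suc n) | ≤⇒≮ᵇ h =
  count->-down-all n (ℕ.≤-trans (ℕ.n≤1+n n) h)

count->-down : ∀ {c n} → c ≤ n → count (c <ᵇ_) (applyDownFrom suc n) ≡ n ∸ c
count->-down {c} {n} h with ℕ.m≤n⇒m<n∨m≡n h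
... | inj₂ ≡.refl = ≡.trans (count->-down-all n ℕ.≤-refl) (≡.sym (ℕ.n∸n≡0 n))
... | inj₁ (s≤s {n = n′} h′)
  rewrite count-∷ (c <ᵇ_) (suc n′) (applyDownFrom suc n′) | <⇒<ᵇ≡true (s≤s h′) =
  ≡.trans (cong suc (count->-down h′)) (≡.sym (ℕ.+-∸-assoc 1 h′))

-- `c` is the first Lehmer digit: the first letter `suc c` exceeds exactly the letters 1, ..., c.
-- The count depends only on the multiset of letters, so it can be evaluated on the list n, ..., 1.
inv-∷-skip : ∀ {c n σ} → c ≤ n → σ ↭ applyDownFrom suc n → inv (suc c ∷ map (skip (suc c)) σ) ≡ c ℕ.+ inv σ
inv-∷-skip {c} {n} {σ} c≤n h = cong₂ ℕ._+_ eq (inv-map-skip (suc c) σ)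
  where
  open ≡-Reasoning
  eq : count (_<ᵇ suc c) (map (skip (suc c)) σ) ≡ c
  eq = begin
    count (_<ᵇ suc c) (map (skip (suc c)) σ)   ≡⟨ count-map _ _ σ ⟩
    count (λ x → skip (suc c) x <ᵇ suc c) σ    ≡⟨ count-cong (skip-<ᵇ (suc c)) σ ⟩
    count (_<ᵇ suc c) σ                        ≡⟨ count-↭ _ h ⟩
    count (_<ᵇ suc c) (applyDownFrom suc n)    ≡⟨ count-≤-down c≤n ⟩
    c                                          ∎

coinv-∷-skip : ∀ {c n σ} → c ≤ n → σ ↭ applyDownFrom suc n →
               coinv (suc c ∷ map (skip (suc c)) σ) ≡ (n ∸ c) ℕ.+ coinv σ
coinv-∷-skip {c} {n} {σ} c≤n h = cong₂ ℕ._+_ eq (coinv-map-skip (suc c) σ)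
  where
  open ≡-Reasoning
  eq : count (suc c <ᵇ_) (map (skip (suc c)) σ) ≡ n ∸ c
  eq = begin
    count (suc c <ᵇ_) (map (skip (suc c)) σ)   ≡⟨ count-map _ _ σ ⟩
    count (λ x → suc c <ᵇ skip (suc c) x) σ    ≡⟨ count-cong (<ᵇ-skip (suc c)) σ ⟩
    count (c <ᵇ_) σ                            ≡⟨ count-↭ _ h ⟩
    count (c <ᵇ_) (applyDownFrom suc n)        ≡⟨ count->-down c≤n ⟩
    n ∸ c                                      ∎

-- Rise patterns as bit lists.

rises : List ℕ → List ℕ → List Bool
rises (a ∷ b ∷ σ) (u ∷ v ∷ w) = ((a <ᵇ b) ∧ (u ≡ᵇ v)) ∷ rises (b ∷ σ) (v ∷ w)
rises _ _ = []

rises-map-skip : ∀ i σ w → rises (map (skip i) σ) w ≡ rises σ w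
rises-map-skip i []          w           = ≡.refl
rises-map-skip i (a ∷ [])    w           = ≡.refl
rises-map-skip i (a ∷ b ∷ σ) []          = ≡.refl
rises-map-skip i (a ∷ b ∷ σ) (u ∷ [])    = ≡.refl
rises-map-skip i (a ∷ b ∷ σ) (u ∷ v ∷ w) =
  cong₂ _∷_ (cong (_∧ (u ≡ᵇ v)) (skip-<ᵇ-skip i a b)) (rises-map-skip i (b ∷ σ) (v ∷ w))

-- Relabelling opens a gap at `suc c`, so a relabelled letter exceeds `suc c` exactly when the
-- original exceeds `c`. A letter of σ equal to `c` stays below the first letter, which agrees with
-- `c <ᵇ c` being false.
rises-∷-skip : ∀ c σ w → rises (suc c ∷ map (skip (suc c)) σ) w ≡ rises (c ∷ σ) w
rises-∷-skip c []      w           = ≡.refl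
rises-∷-skip c (b ∷ σ) []          = ≡.refl
rises-∷-skip c (b ∷ σ) (u ∷ [])    = ≡.refl
rises-∷-skip c (b ∷ σ) (u ∷ v ∷ w) =
  cong₂ _∷_ (cong (_∧ (u ≡ᵇ v)) (<ᵇ-skip (suc c) b)) (rises-map-skip (suc c) (b ∷ σ) (v ∷ w))

length-rises : ∀ a σ w → length (rises (a ∷ σ) w) ≤ length σ
length-rises a []      w           = z≤n
length-rises a (b ∷ σ) []          = z≤n
length-rises a (b ∷ σ) (u ∷ [])    = z≤n
length-rises a (b ∷ σ) (u ∷ v ∷ w) = s≤s (length-rises b σ (v ∷ w))

positions : ℕ → List Bool → List ℕ
positions i []       = []
positions i (b ∷ bs) = if b then i ∷ positions (suc i) bs else positions (suc i) bs

wrisFrom≡positions : ∀ i σ w → wrisFrom i σ w ≡ positions i (rises σ w)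
wrisFrom≡positions i []          w           = ≡.refl
wrisFrom≡positions i (a ∷ [])    w           = ≡.refl
wrisFrom≡positions i (a ∷ b ∷ σ) []          = ≡.refl
wrisFrom≡positions i (a ∷ b ∷ σ) (u ∷ [])    = ≡.refl
wrisFrom≡positions i (a ∷ b ∷ σ) (u ∷ v ∷ w)
  rewrite wrisFrom≡positions (suc i) (b ∷ σ) (v ∷ w) = ≡.refl

<⇒≢ᵇ : ∀ {m n} → m < n → (n ≡ᵇ m) ≡ false
<⇒≢ᵇ {zero}  {suc n} h       = ≡.refl
<⇒≢ᵇ {suc m} {suc n} (s≤s h) = <⇒≢ᵇ h

≡ᵇ-refl : ∀ n → (n ≡ᵇ n) ≡ true
≡ᵇ-refl zero    = ≡.refl
≡ᵇ-refl (suc n) = ≡ᵇ-refl n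

-- Solving the recursions for U and V in an arbitrary commutative ring.

module Quotients {c ℓ} (R : CommutativeRing c ℓ) where
  open CommutativeRing R
  open import Algebra.Properties.Group +-group using () renaming (∙-cancelʳ to +-cancelʳ)
  open import Algebra.Solver.Ring.NaturalCoefficients.Default commutativeSemiring using (solve; _:+_; _:*_; _:=_)
  open import Relation.Binary.Reasoning.Setoid setoid

  solve-for-u : ∀ p q u n₀ → p * n₀ ≈ 1# → p * u ≈ q * n₀ → u * p * p ≈ q
  solve-for-u p q u n₀ pn₀≈1 pu≈qn₀ = begin
    u * p * p      ≈⟨ *-congʳ (trans (*-comm u p) pu≈qn₀) ⟩
    q * n₀ * p     ≈⟨ trans (*-assoc q n₀ p) (*-congˡ (trans (*-comm n₀ p) pn₀≈1)) ⟩
    q * 1#         ≈⟨ *-identityʳ q ⟩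
    q              ∎

  -- `n₀` is an inverse of `p`, so p²n₂ = (g²+ph)/p and p²u = q; since v = n₂ - u, this gives p³v =
  -- g² + ph - pq. The difference h - q enters as `x` with `h ≈ x + q`, and `p * q` is cancelled at
  -- the end, so that no subtraction occurs.
  solve-for-v : ∀ p q g h x u v n₀ n₁ n₂ → p * n₀ ≈ 1# → p * n₁ ≈ g * n₀ → p * n₂ ≈ g * n₁ + h * n₀ →
    p * u ≈ q * n₀ → u + v ≈ n₂ → h ≈ x + q → v * p * p * p ≈ g * g + p * x
  solve-for-v p q g h x u v n₀ n₁ n₂ pn₀≈1 pn₁≈gn₀ pn₂≈ pu≈qn₀ u+v≈n₂ h≈x+q =
    +-cancelʳ (p * q) _ _ (begin
      v * p * p * p + p * q
        ≈⟨ +-congˡ (*-congˡ (solve-for-u p q u n₀ pn₀≈1 pu≈qn₀)) ⟨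
      v * p * p * p + p * (u * p * p)
        ≈⟨ solve 3 (λ u v p → v :* p :* p :* p :+ p :* (u :* p :* p) := p :* (u :+ v) :* (p :* p)) refl u v p ⟩
      p * (u + v) * (p * p)
        ≈⟨ *-congʳ (trans (*-congˡ u+v≈n₂) pn₂≈) ⟩
      (g * n₁ + h * n₀) * (p * p)
        ≈⟨ solve 5 (λ g n₁ h n₀ p → (g :* n₁ :+ h :* n₀) :* (p :* p) :=
             g :* p :* (p :* n₁) :+ p :* h :* (p :* n₀)) refl g n₁ h n₀ p ⟩
      g * p * (p * n₁) + p * h * (p * n₀)
        ≈⟨ +-cong (*-congˡ pn₁≈gn₀) (*-congˡ pn₀≈1) ⟩
      g * p * (g * n₀) + p * h * 1#
        ≈⟨ +-cong (solve 3 (λ g n₀ p → g :* p :* (g :* n₀) := g :* g :* (p :* n₀)) refl g n₀ p) (*-identityʳ _) ⟩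
      g * g * (p * n₀) + p * h
        ≈⟨ +-cong (trans (*-congˡ pn₀≈1) (*-identityʳ _)) (*-congˡ h≈x+q) ⟩
      g * g + p * (x + q)
        ≈⟨ solve 4 (λ g p x q → g :* g :+ p :* (x :+ q) := (g :* g :+ p :* x) :+ p :* q) refl g p x q ⟩
      (g * g + p * x) + p * q ∎)

-- Finite sums over lists and over initial segments.

module RiseSeries {c ℓ} (R : CommutativeRing c ℓ) where
  open CommutativeRing R hiding (zero)
  open WithRing R
  open import Algebra.Properties.Group +-group using () renaming (∙-cancelʳ to +-cancelʳ; ∙-cancelˡ to +-cancelˡ)
  open import Algebra.Properties.Ring ring using (-0#≈0#; -‿involutive; -‿+-comm; -1*x≈-x; -‿distribˡ-*)
  open import Algebra.Solver.Ring.NaturalCoefficients.Default commutativeSemiring using (solve; _:+_; _:*_; _:=_; con)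
  open import Relation.Binary.Reasoning.Setoid setoid

  private variable
    X Y : Set

  +-interchange : ∀ a b c d → (a + b) + (c + d) ≈ (a + c) + (b + d)
  +-interchange = solve 4 (λ a b c d → (a :+ b) :+ (c :+ d) := (a :+ c) :+ (b :+ d)) refl

  sumList : (X → Carrier) → List X → Carrier
  sumList f []       = 0#
  sumList f (x ∷ xs) = f x + sumList f xs

  sumList-congAll : ∀ {f g : X → Carrier} {xs} → All (λ x → f x ≈ g x) xs → sumList f xs ≈ sumList g xs
  sumList-congAll []      = refl
  sumList-congAll (h ∷ k) = +-cong h (sumList-congAll k)

  sumList-cong : ∀ {f g : X → Carrier} → (∀ x → f x ≈ g x) → ∀ xs → sumList f xs ≈ sumList g xs
  sumList-cong h []       = refl
  sumList-cong h (x ∷ xs) = +-cong (h x) (sumList-cong h xs)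

  sumList-+ : ∀ (f g : X → Carrier) xs → sumList (λ x → f x + g x) xs ≈ sumList f xs + sumList g xs
  sumList-+ f g []       = sym (+-identityˡ 0#)
  sumList-+ f g (x ∷ xs) = trans (+-congˡ (sumList-+ f g xs)) (+-interchange _ _ _ _)

  sumList-0 : ∀ (xs : List X) → sumList (λ _ → 0#) xs ≈ 0#
  sumList-0 []       = refl
  sumList-0 (x ∷ xs) = trans (+-identityˡ _) (sumList-0 xs)

  sumList-*ˡ : ∀ a (f : X → Carrier) xs → sumList (λ x → a * f x) xs ≈ a * sumList f xs
  sumList-*ˡ a f []       = sym (zeroʳ a)
  sumList-*ˡ a f (x ∷ xs) = trans (+-congˡ (sumList-*ˡ a f xs)) (sym (distribˡ a _ _))

  sumList-++ : ∀ (f : X → Carrier) xs ys → sumList f (xs ++ ys) ≈ sumList f xs + sumList f ys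
  sumList-++ f []       ys = sym (+-identityˡ _)
  sumList-++ f (x ∷ xs) ys = trans (+-congˡ (sumList-++ f xs ys)) (sym (+-assoc _ _ _))

  sumList-map : ∀ (f : Y → Carrier) (g : X → Y) xs → sumList f (map g xs) ≈ sumList (λ x → f (g x)) xs
  sumList-map f g []       = refl
  sumList-map f g (x ∷ xs) = +-congˡ (sumList-map f g xs)

  sumList-concatMap : ∀ (f : Y → Carrier) (g : X → List Y) xs →
    sumList f (concatMap g xs) ≈ sumList (λ x → sumList f (g x)) xs
  sumList-concatMap f g []       = refl
  sumList-concatMap f g (x ∷ xs) = trans (sumList-++ f (g x) _) (+-congˡ (sumList-concatMap f g xs))

  sumBelow-cong< : ∀ n {f g} → (∀ i → i < n → f i ≈ g i) → sumBelow n f ≈ sumBelow n g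
  sumBelow-cong< zero    h = refl
  sumBelow-cong< (suc n) h = +-cong (sumBelow-cong< n (λ i i<n → h i (ℕ.m≤n⇒m≤1+n i<n))) (h n ℕ.≤-refl)

  sumBelow-cong : ∀ n {f g} → (∀ i → f i ≈ g i) → sumBelow n f ≈ sumBelow n g
  sumBelow-cong n h = sumBelow-cong< n (λ i _ → h i)

  sumBelow-+ : ∀ n f g → sumBelow n (λ i → f i + g i) ≈ sumBelow n f + sumBelow n g
  sumBelow-+ zero    f g = sym (+-identityˡ 0#)
  sumBelow-+ (suc n) f g = trans (+-congʳ (sumBelow-+ n f g)) (+-interchange _ _ _ _)

  sumBelow-0 : ∀ n → sumBelow n (λ _ → 0#) ≈ 0#
  sumBelow-0 zero    = refl
  sumBelow-0 (suc n) = trans (+-identityʳ _) (sumBelow-0 n)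

  sumBelow-*ˡ : ∀ n a f → sumBelow n (λ i → a * f i) ≈ a * sumBelow n f
  sumBelow-*ˡ zero    a f = sym (zeroʳ a)
  sumBelow-*ˡ (suc n) a f = trans (+-congʳ (sumBelow-*ˡ n a f)) (sym (distribˡ a _ _))

  sumBelow-front : ∀ n f → sumBelow (suc n) f ≈ f 0 + sumBelow n (λ i → f (suc i))
  sumBelow-front zero    f = +-comm 0# (f 0)
  sumBelow-front (suc n) f = trans (+-congʳ (sumBelow-front n f)) (+-assoc _ _ _)

  sumList-upTo : ∀ f n → sumList f (upTo n) ≈ sumBelow n f
  sumList-upTo f zero    = refl
  sumList-upTo f (suc n) = begin
    f 0 + sumList f (applyUpTo suc n)               ≈⟨ +-congˡ (reflexive (cong (sumList f) (≡.sym (map-upTo suc n)))) ⟩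
    f 0 + sumList f (map suc (upTo n))              ≈⟨ +-congˡ (sumList-map f suc (upTo n)) ⟩
    f 0 + sumList (λ i → f (suc i)) (upTo n)        ≈⟨ +-congˡ (sumList-upTo _ n) ⟩
    f 0 + sumBelow n (λ i → f (suc i))              ≈⟨ sumBelow-front n f ⟨
    sumBelow (suc n) f                              ∎

  sumList-sumBelow : ∀ n (f : X → ℕ → Carrier) xs →
    sumList (λ x → sumBelow n (f x)) xs ≈ sumBelow n (λ i → sumList (λ x → f x i) xs)
  sumList-sumBelow zero    f xs = sumList-0 xs
  sumList-sumBelow (suc n) f xs = trans (sumList-+ _ _ xs) (+-congʳ (sumList-sumBelow n f xs))

  -- Enumerating permutations and C_k ≀ S_n by the first letter.

  -- By induction the shorter permutations are already sorted by first letter. The new largest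
  -- letter goes either to the front (`top`) or behind the first letter (`below`), and in the second
  -- case insertion commutes with relabelling. The claim concerns sums because the two enumerations
  -- list the permutations in different orders.
  sumList-perms : ∀ n f → sumList f (perms (suc n)) ≈
    sumBelow (suc n) (λ c → sumList (λ τ → f (suc c ∷ map (skip (suc c)) τ)) (perms n))
  sumList-perms zero f = trans (+-identityʳ _) (sym (trans (+-identityˡ _) (+-identityʳ _)))
  sumList-perms (suc n) f = begin
    sumList f (concatMap (insertions (2 ℕ.+ n)) (perms (suc n)))
      ≈⟨ sumList-concatMap f (insertions (2 ℕ.+ n)) (perms (suc n)) ⟩
    sumList g (perms (suc n))
      ≈⟨ sumList-perms n g ⟩
    sumBelow (suc n) (λ c → sumList (λ τ → g (suc c ∷ map (skip (suc c)) τ)) (perms n))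
      ≈⟨ sumBelow-cong< (suc n) (λ { c (s≤s c≤n) → sumList-cong (λ τ → +-congˡ (insert-deeper c τ c≤n)) (perms n) }) ⟩
    sumBelow (suc n) (λ c → sumList (λ τ → top (suc c ∷ map (skip (suc c)) τ) + below c τ) (perms n))
      ≈⟨ sumBelow-cong (suc n) (λ c → sumList-+ _ _ (perms n)) ⟩
    sumBelow (suc n) (λ c → sumList (λ τ → top (suc c ∷ map (skip (suc c)) τ)) (perms n) + sumList (below c) (perms n))
      ≈⟨ sumBelow-+ (suc n) _ _ ⟩
    sumBelow (suc n) (λ c → sumList (λ τ → top (suc c ∷ map (skip (suc c)) τ)) (perms n)) +
    sumBelow (suc n) (λ c → sumList (below c) (perms n))
      ≈⟨ +-cong (sym (sumList-perms n top))
                (sumBelow-cong (suc n) (λ c → sym (sumList-concatMap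
                  (λ ρ → f (suc c ∷ map (skip (suc c)) ρ)) (insertions (suc n)) (perms n)))) ⟩
    sumList top (perms (suc n)) +
    sumBelow (suc n) (λ c → sumList (λ ρ → f (suc c ∷ map (skip (suc c)) ρ)) (perms (suc n)))
      ≈⟨ +-comm _ _ ⟩
    sumBelow (suc n) (λ c → sumList (λ ρ → f (suc c ∷ map (skip (suc c)) ρ)) (perms (suc n))) + sumList top (perms (suc n))
      -- With the largest letter in front, relabelling moves nothing, so `top` is the last summand,
      -- `c = suc n`.
      ≈⟨ +-congˡ (sumList-congAll (All.map
           (λ h → reflexive (cong (λ τ → f (2 ℕ.+ n ∷ τ)) (≡.sym (map-skip-id (bounded h))))) (perms-↭ (suc n)))) ⟩
    sumBelow (2 ℕ.+ n) (λ c → sumList (λ τ → f (suc c ∷ map (skip (suc c)) τ)) (perms (suc n))) ∎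
    where
    g top : List ℕ → Carrier
    g σ   = sumList f (insertions (2 ℕ.+ n) σ)
    top σ = f (2 ℕ.+ n ∷ σ)
    below : ℕ → List ℕ → Carrier
    below c τ = sumList (λ ρ → f (suc c ∷ map (skip (suc c)) ρ)) (insertions (suc n) τ)
    bounded : ∀ {σ} → σ ↭ applyDownFrom suc (suc n) → All (_< 2 ℕ.+ n) σ
    bounded h = All-resp-↭ (↭-sym h) (down-< (suc n))
    insert-deeper : ∀ c τ → c ≤ n →
      sumList f (map (suc c ∷_) (insertions (2 ℕ.+ n) (map (skip (suc c)) τ))) ≈ below c τ
    insert-deeper c τ c≤n = begin
      sumList f (map (suc c ∷_) (insertions (2 ℕ.+ n) (map (skip (suc c)) τ)))
        ≈⟨ sumList-map f (suc c ∷_) (insertions (2 ℕ.+ n) (map (skip (suc c)) τ)) ⟩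
      sumList (λ ρ → f (suc c ∷ ρ)) (insertions (2 ℕ.+ n) (map (skip (suc c)) τ))
        -- As `c ≤ n`, the largest letter is itself a relabelled letter, the image of `suc n`.
        ≡⟨ cong (λ m → sumList (λ ρ → f (suc c ∷ ρ)) (insertions m (map (skip (suc c)) τ))) (≡.sym (skip-≥ (s≤s c≤n))) ⟩
      sumList (λ ρ → f (suc c ∷ ρ)) (insertions (skip (suc c) (suc n)) (map (skip (suc c)) τ))
        ≡⟨ cong (sumList _) (insertions-map (skip (suc c)) (suc n) τ) ⟩
      sumList (λ ρ → f (suc c ∷ ρ)) (map (map (skip (suc c))) (insertions (suc n) τ))
        ≈⟨ sumList-map (λ ρ → f (suc c ∷ ρ)) (map (skip (suc c))) (insertions (suc n) τ) ⟩
      below c τ ∎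

  module _ (k : ℕ) where

    sumList-words : ∀ n f → sumList f (words k (suc n)) ≈ sumList (λ w → sumBelow k (λ u → f (u ∷ w))) (words k n)
    sumList-words n f = trans (sumList-concatMap f _ (words k n))
      (sumList-cong (λ w → trans (sumList-map f (_∷ w) (upTo k)) (sumList-upTo _ k)) (words k n))

    sumList-wreath : ∀ n (F : List ℕ × List ℕ → Carrier) →
      sumList F (wreath n k) ≈ sumList (λ σ → sumList (λ w → F (σ , w)) (words k n)) (perms n)
    sumList-wreath n F = trans (sumList-concatMap F _ (perms n))
      (sumList-cong (λ σ → sumList-map F (σ ,_) (words k n)) (perms n))

    sumList-wreath-suc : ∀ n (F : List ℕ × List ℕ → Carrier) → sumList F (wreath (suc n) k) ≈
      sumBelow (suc n) (λ c → sumBelow k (λ u →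
        sumList (λ (τ , w) → F (suc c ∷ map (skip (suc c)) τ , u ∷ w)) (wreath n k)))
    sumList-wreath-suc n F = begin
      sumList F (wreath (suc n) k)
        ≈⟨ sumList-wreath (suc n) F ⟩
      sumList (λ σ → sumList (λ w → F (σ , w)) (words k (suc n))) (perms (suc n))
        ≈⟨ sumList-perms n _ ⟩
      sumBelow (suc n) (λ c → sumList (λ τ → sumList (λ w → F (first c τ , w)) (words k (suc n))) (perms n))
        ≈⟨ sumBelow-cong (suc n) (λ c → sumList-cong (λ τ →
             trans (sumList-words n (λ w → F (first c τ , w))) (sumList-sumBelow k _ (words k n))) (perms n)) ⟩
      sumBelow (suc n) (λ c → sumList (λ τ → sumBelow k (λ u → sumList (λ w → F (first c τ , u ∷ w)) (words k n))) (perms n))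
        ≈⟨ sumBelow-cong (suc n) (λ c → sumList-sumBelow k _ (perms n)) ⟩
      sumBelow (suc n) (λ c → sumBelow k (λ u → sumList (λ τ → sumList (λ w → F (first c τ , u ∷ w)) (words k n)) (perms n)))
        ≈⟨ sumBelow-cong (suc n) (λ c → sumBelow-cong k (λ u → sym (sumList-wreath n _))) ⟩
      sumBelow (suc n) (λ c → sumBelow k (λ u →
        sumList (λ (τ , w) → F (suc c ∷ map (skip (suc c)) τ , u ∷ w)) (wreath n k))) ∎
      where
      first : ℕ → List ℕ → List ℕ
      first c τ = suc c ∷ map (skip (suc c)) τ

    wreath-All : ∀ n {Pr : List ℕ → Set} → All Pr (perms n) → All (λ x → Pr (proj₁ x)) (wreath n k)
    wreath-All n h = All.concat⁺ (All.map⁺ (All.map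
      (λ {σ} hσ → All.map⁺ (All.universal (λ _ → hσ) (words k n))) h))

    wreath-↭ : ∀ n → All (λ x → proj₁ x ↭ applyDownFrom suc n) (wreath n k)
    wreath-↭ n = wreath-All n (perms-↭ n)

  -- Indicators and powers.

  ⟦_⟧ : Bool → Carrier
  ⟦ b ⟧ = if b then 1# else 0#

  ⟦⟧-∧ : ∀ b b′ → ⟦ b ∧ b′ ⟧ ≈ ⟦ b ⟧ * ⟦ b′ ⟧
  ⟦⟧-∧ true  b′ = sym (*-identityˡ _)
  ⟦⟧-∧ false b′ = sym (zeroˡ _)

  ^'-+ : ∀ x m n → x ^' (m ℕ.+ n) ≈ (x ^' m) * (x ^' n)
  ^'-+ x zero    n = sym (*-identityˡ _)
  ^'-+ x (suc m) n = trans (*-congˡ (^'-+ x m n)) (sym (*-assoc x _ _))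

  ^'-distrib-* : ∀ x y n → (x * y) ^' n ≈ (x ^' n) * (y ^' n)
  ^'-distrib-* x y zero    = sym (*-identityˡ _)
  ^'-distrib-* x y (suc n) = trans (*-congˡ (^'-distrib-* x y n))
    (solve 4 (λ a b c d → (a :* b) :* (c :* d) := (a :* c) :* (b :* d)) refl x y _ _)

  1^' : ∀ n → 1# ^' n ≈ 1#
  1^' zero    = refl
  1^' (suc n) = trans (*-identityˡ _) (1^' n)

  ^'-comm : ∀ x m n → (x ^' m) ^' n ≈ (x ^' n) ^' m
  ^'-comm x zero    n = 1^' n
  ^'-comm x (suc m) n = trans (^'-distrib-* x (x ^' m) n) (*-congˡ (^'-comm x m n))

  sumBelow-≡ᵇ : ∀ k u f → u < k → sumBelow k (λ v → ⟦ u ≡ᵇ v ⟧ * f v) ≈ f u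
  sumBelow-≡ᵇ (suc k) zero f h = begin
    sumBelow (suc k) (λ v → ⟦ 0 ≡ᵇ v ⟧ * f v)          ≈⟨ sumBelow-front k _ ⟩
    1# * f 0 + sumBelow k (λ v → 0# * f (suc v))       ≈⟨ +-cong (*-identityˡ _) (sumBelow-cong k (λ v → zeroˡ _)) ⟩
    f 0 + sumBelow k (λ v → 0#)                        ≈⟨ +-congˡ (sumBelow-0 k) ⟩
    f 0 + 0#                                           ≈⟨ +-identityʳ _ ⟩
    f 0                                                ∎
  sumBelow-≡ᵇ (suc k) (suc u) f (s≤s h) = begin
    sumBelow (suc k) (λ v → ⟦ suc u ≡ᵇ v ⟧ * f v)              ≈⟨ sumBelow-front k _ ⟩
    0# * f 0 + sumBelow k (λ v → ⟦ u ≡ᵇ v ⟧ * f (suc v))       ≈⟨ +-cong (zeroˡ _) (sumBelow-≡ᵇ k u (λ v → f (suc v)) h) ⟩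
    0# + f (suc u)                                             ≈⟨ +-identityˡ _ ⟩
    f (suc u)                                                  ∎

  -- Putting a block in front of a rise pattern.

  -- A block of l letters gives l ∸ 1 forced rises and a free bit at the junction with the rest;
  -- the junction is missing when the block is everything.
  block : ℕ → (List Bool → Carrier) → List Bool → Carrier
  block zero          Φ β       = Φ β
  block (suc zero)    Φ []      = Φ []
  block (suc zero)    Φ (b ∷ β) = Φ β
  block (suc (suc l)) Φ []      = 0#
  block (suc (suc l)) Φ (b ∷ β) = ⟦ b ⟧ * block (suc l) Φ β

  -- `y i` is the coefficient of a block of `i + 1` letters. The sum over all block lengths is
  -- written as a recursion on bits, so that induction on the pattern sees a shift of `y`; blocks
  -- that do not fit drop out at `[]`.
  blocks : (ℕ → Carrier) → (List Bool → Carrier) → List Bool → Carrier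
  blocks y Φ []      = y 0 * Φ []
  blocks y Φ (b ∷ β) = y 0 * Φ β + ⟦ b ⟧ * blocks (λ i → y (suc i)) Φ β

  blocks≈sumBelow : ∀ n y Φ β → length β ≤ n → blocks y Φ β ≈ sumBelow (suc n) (λ i → y i * block (suc i) Φ β)
  blocks≈sumBelow n y Φ [] h = sym (begin
    sumBelow (suc n) (λ i → y i * block (suc i) Φ [])         ≈⟨ sumBelow-front n _ ⟩
    y 0 * Φ [] + sumBelow n (λ i → y (suc i) * 0#)            ≈⟨ +-congˡ (sumBelow-cong n (λ i → zeroʳ _)) ⟩
    y 0 * Φ [] + sumBelow n (λ i → 0#)                        ≈⟨ +-congˡ (sumBelow-0 n) ⟩
    y 0 * Φ [] + 0#                                           ≈⟨ +-identityʳ _ ⟩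
    y 0 * Φ []                                                ∎)
  blocks≈sumBelow (suc n) y Φ (b ∷ β) (s≤s h) = sym (begin
    sumBelow (2 ℕ.+ n) (λ i → y i * block (suc i) Φ (b ∷ β))
      ≈⟨ sumBelow-front (suc n) _ ⟩
    y 0 * Φ β + sumBelow (suc n) (λ i → y (suc i) * (⟦ b ⟧ * block (suc i) Φ β))
      ≈⟨ +-congˡ (sumBelow-cong (suc n) (λ i → solve 3 (λ a b c → a :* (b :* c) := b :* (a :* c)) refl _ _ _)) ⟩
    y 0 * Φ β + sumBelow (suc n) (λ i → ⟦ b ⟧ * (y (suc i) * block (suc i) Φ β))
      ≈⟨ +-congˡ (sumBelow-*ˡ (suc n) ⟦ b ⟧ _) ⟩
    y 0 * Φ β + ⟦ b ⟧ * sumBelow (suc n) (λ i → y (suc i) * block (suc i) Φ β)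
      ≈⟨ +-congˡ (*-congˡ (blocks≈sumBelow n (λ i → y (suc i)) Φ β h)) ⟨
    blocks y Φ (b ∷ β) ∎)

  -- p,q-integers and the weight of increasing Lehmer codes.

  module _ (p q : Carrier) where

    pqInt-suc : ∀ n → pqInt p q (suc n) ≈ p ^' n + q * pqInt p q n
    pqInt-suc zero = trans (+-identityˡ _) (trans (*-identityˡ _) (sym (trans (+-congˡ (zeroʳ q)) (+-identityʳ _))))
    pqInt-suc (suc n) = trans (sumBelow-front (suc n) _) (+-cong (*-identityʳ _)
      (trans (sumBelow-cong (suc n) λ i → solve 3 (λ a b c → a :* (b :* c) := b :* (a :* c)) refl (p ^' (n ∸ i)) q (q ^' i))
             (sumBelow-*ˡ (suc n) q _)))

    pqInt-+ : ∀ m n → pqInt p q (m ℕ.+ n) ≈ (p ^' n) * pqInt p q m + (q ^' m) * pqInt p q n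
    pqInt-+ zero    n = sym (trans (+-cong (zeroʳ _) (*-identityˡ _)) (+-identityˡ _))
    pqInt-+ (suc m) n = begin
      pqInt p q (suc (m ℕ.+ n))
        ≈⟨ pqInt-suc (m ℕ.+ n) ⟩
      p ^' (m ℕ.+ n) + q * pqInt p q (m ℕ.+ n)
        ≈⟨ +-cong (^'-+ p m n) (*-congˡ (pqInt-+ m n)) ⟩
      (p ^' m) * (p ^' n) + q * ((p ^' n) * pqInt p q m + (q ^' m) * pqInt p q n)
        ≈⟨ solve 6 (λ a b c d e f → a :* b :+ c :* (b :* d :+ e :* f) := b :* (a :+ c :* d) :+ (c :* e) :* f) refl _ _ _ _ _ _ ⟩
      (p ^' n) * (p ^' m + q * pqInt p q m) + (q * (q ^' m)) * pqInt p q n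
        ≈⟨ +-congʳ (*-congˡ (pqInt-suc m)) ⟨
      (p ^' n) * pqInt p q (suc m) + (q ^' suc m) * pqInt p q n ∎

    ^'-C2 : ∀ l → p ^' (suc l C 2) ≈ (p ^' l) * (p ^' (l C 2))
    ^'-C2 l = trans (reflexive (cong (p ^'_) (≡.trans (≡.sym (nCk+nC[k+1]≡[n+1]C[k+1] l 1)) (cong (ℕ._+ l C 2) (nC1≡n l)))))
                    (^'-+ p l (l C 2))

    -- The weight of one Lehmer digit: a letter followed by `n` letters, `c` of them smaller and
    -- `n ∸ c` larger.
    ω : ℕ → ℕ → Carrier
    ω n c = (q ^' c) * (p ^' (n ∸ c))

    -- Sum over the Lehmer codes c ≤ c₁ ≤ … ≤ c_l ≤ m of an increasing block followed by m letters.
    chains : ℕ → ℕ → ℕ → Carrier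
    chains zero    m c = 1#
    chains (suc l) m c = sumBelow (suc (l ℕ.+ m)) (λ c′ → ⟦ c <ᵇ suc c′ ⟧ * (ω (l ℕ.+ m) c′ * chains l m c′))

    -- All `l` digits are at least 1. Lowering each digit and its upper bound by 1 removes one
    -- factor `q` per digit and leaves the exponents of `p` unchanged.
    chains-shift : ∀ l m c → chains l (suc m) (suc c) ≈ (q ^' l) * chains l m c
    chains-shift zero    m c = sym (*-identityˡ _)
    chains-shift (suc l) m c rewrite ℕ.+-suc l m = begin
      sumBelow (2 ℕ.+ n) (λ i → ⟦ suc c <ᵇ suc i ⟧ * (ω (suc n) i * chains l (suc m) i))
        ≈⟨ sumBelow-front (suc n) _ ⟩
      0# * _ + sumBelow (suc n) (λ i → ⟦ c <ᵇ suc i ⟧ * (ω (suc n) (suc i) * chains l (suc m) (suc i)))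
        ≈⟨ +-cong (zeroˡ _) (sumBelow-cong (suc n) λ i → trans (*-congˡ (*-congˡ (chains-shift l m i)))
             (solve 6 (λ a b c d e f → a :* (((b :* c) :* d) :* (e :* f)) := (b :* e) :* (a :* ((c :* d) :* f))) refl _ _ _ _ _ _)) ⟩
      0# + sumBelow (suc n) (λ i → (q ^' suc l) * (⟦ c <ᵇ suc i ⟧ * (ω n i * chains l m i)))
        ≈⟨ trans (+-identityˡ _) (sumBelow-*ˡ (suc n) _ _) ⟩
      (q ^' suc l) * chains (suc l) m c ∎
      where
      n : ℕ
      n = l ℕ.+ m

    -- With no letters behind the block its last digit is 0, which a positive lower bound forbids.
    chains-0 : ∀ l c → chains (suc l) 0 (suc c) ≈ 0#
    chains-0 l c = begin
      chains (suc l) 0 (suc c)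
        ≈⟨ sumBelow-front (l ℕ.+ 0) _ ⟩
      0# * _ + sumBelow (l ℕ.+ 0) (λ i → ⟦ c <ᵇ suc i ⟧ * (ω (l ℕ.+ 0) (suc i) * chains l 0 (suc i)))
        ≈⟨ +-cong (zeroˡ _) (rest l) ⟩
      0# + 0#
        ≈⟨ +-identityˡ _ ⟩
      0# ∎
      where
      rest : ∀ l → sumBelow (l ℕ.+ 0) (λ i → ⟦ c <ᵇ suc i ⟧ * (ω (l ℕ.+ 0) (suc i) * chains l 0 (suc i))) ≈ 0#
      rest zero    = refl
      rest (suc l) = trans
        (sumBelow-cong (suc l ℕ.+ 0) λ i → trans (*-congˡ (trans (*-congˡ (chains-0 l i)) (zeroʳ _))) (zeroʳ _))
        (sumBelow-0 (suc l ℕ.+ 0))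

    chains-suc : ∀ l m → chains (suc l) m 0 ≈ (p ^' (l ℕ.+ m)) * chains l m 0 + chains (suc l) m 1
    chains-suc l m = trans (sumBelow-front (l ℕ.+ m) _) (+-cong
      (trans (*-identityˡ _) (*-congʳ (*-identityˡ _)))
      (sym (trans (sumBelow-front (l ℕ.+ m) _) (trans (+-congʳ (zeroˡ _)) (+-identityˡ _)))))

    -- This is `chains l m 0` = p^C(l,2) times the p,q-binomial of l+m over l, with denominators
    -- cleared. Asking whether the smallest digit is 0 (`chains-suc`), and shifting when it is not,
    -- gives a p,q-Pascal recursion; `pqInt-+` merges its two terms. For `m = 0` the second term
    -- vanishes by `chains-0`.
    chains-pqFact : ∀ l m → chains l m 0 * (pqFact p q l * pqFact p q m) ≈ (p ^' (l C 2)) * pqFact p q (l ℕ.+ m)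
    chains-pqFact zero    m = *-congˡ (*-identityˡ _)
    chains-pqFact (suc l) zero = begin
      chains (suc l) 0 0 * ((pqInt p q (suc l) * pqFact p q l) * 1#)
        ≈⟨ *-congʳ (trans (chains-suc l 0) (trans (+-congˡ (chains-0 l 0)) (+-identityʳ _))) ⟩
      ((p ^' (l ℕ.+ 0)) * chains l 0 0) * ((pqInt p q (suc l) * pqFact p q l) * 1#)
        ≈⟨ solve 5 (λ a b c d e → (a :* b) :* ((c :* d) :* e) := (a :* c) :* (b :* (d :* e))) refl _ _ _ _ _ ⟩
      ((p ^' (l ℕ.+ 0)) * pqInt p q (suc l)) * (chains l 0 0 * (pqFact p q l * 1#))
        ≈⟨ *-congˡ (chains-pqFact l 0) ⟩
      ((p ^' (l ℕ.+ 0)) * pqInt p q (suc l)) * ((p ^' (l C 2)) * pqFact p q (l ℕ.+ 0))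
        ≡⟨ cong (λ n → ((p ^' n) * pqInt p q (suc l)) * ((p ^' (l C 2)) * pqFact p q (l ℕ.+ 0))) (ℕ.+-identityʳ l) ⟩
      ((p ^' l) * pqInt p q (suc l)) * ((p ^' (l C 2)) * pqFact p q (l ℕ.+ 0))
        ≈⟨ solve 4 (λ a b c d → (a :* b) :* (c :* d) := (a :* c) :* (b :* d)) refl _ _ _ _ ⟩
      ((p ^' l) * (p ^' (l C 2))) * (pqInt p q (suc l) * pqFact p q (l ℕ.+ 0))
        ≈⟨ *-cong (sym (^'-C2 l)) (*-congʳ (reflexive (cong (λ n → pqInt p q (suc n)) (≡.sym (ℕ.+-identityʳ l))))) ⟩
      (p ^' (suc l C 2)) * pqFact p q (suc (l ℕ.+ 0)) ∎
    chains-pqFact (suc l) (suc m) = begin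
      chains (suc l) (suc m) 0 * ((pqInt p q (suc l) * pqFact p q l) * (pqInt p q (suc m) * pqFact p q m))
        ≈⟨ *-congʳ (trans (chains-suc l (suc m)) (+-cong (*-congʳ (^'-+ p l (suc m))) (chains-shift (suc l) m 0))) ⟩
      (((p ^' l) * (p ^' suc m)) * chains l (suc m) 0 + (q ^' suc l) * chains (suc l) m 0) *
      ((pqInt p q (suc l) * pqFact p q l) * (pqInt p q (suc m) * pqFact p q m))
        ≈⟨ solve 9 (λ a b c d e f g h i → ((a :* b) :* c :+ d :* e) :* ((f :* g) :* (h :* i)) :=
             (a :* b :* f) :* (c :* (g :* (h :* i))) :+ (d :* h) :* (e :* ((f :* g) :* i))) refl _ _ _ _ _ _ _ _ _ ⟩
      ((p ^' l) * (p ^' suc m) * pqInt p q (suc l)) * (chains l (suc m) 0 * (pqFact p q l * pqFact p q (suc m))) +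
      ((q ^' suc l) * pqInt p q (suc m)) * (chains (suc l) m 0 * (pqFact p q (suc l) * pqFact p q m))
        ≈⟨ +-cong (*-congˡ (chains-pqFact l (suc m))) (*-congˡ (trans (chains-pqFact (suc l) m)
             (*-cong (^'-C2 l) (reflexive (cong (pqFact p q) (≡.sym (ℕ.+-suc l m))))))) ⟩
      ((p ^' l) * (p ^' suc m) * pqInt p q (suc l)) * ((p ^' (l C 2)) * pqFact p q (l ℕ.+ suc m)) +
      ((q ^' suc l) * pqInt p q (suc m)) * (((p ^' l) * (p ^' (l C 2))) * pqFact p q (l ℕ.+ suc m))
        ≈⟨ solve 7 (λ a b c d e f g → (a :* b :* c) :* (d :* e) :+ (f :* g) :* ((a :* d) :* e) :=
             (a :* d) :* ((b :* c :+ f :* g) :* e)) refl _ _ _ _ _ _ _ ⟩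
      ((p ^' l) * (p ^' (l C 2))) * (((p ^' suc m) * pqInt p q (suc l) + (q ^' suc l) * pqInt p q (suc m)) * pqFact p q (l ℕ.+ suc m))
        ≈⟨ *-cong (^'-C2 l) (*-congʳ (pqInt-+ (suc l) (suc m))) ⟨
      (p ^' (suc l C 2)) * pqFact p q (suc (l ℕ.+ suc m)) ∎

  -- Weighted sums of functions of the rise pattern.

  module _ (k : ℕ) (p q r : Carrier) where

    weight : List ℕ × List ℕ → Carrier
    weight (σ , w) = (q ^' inv σ) * (p ^' coinv σ) * (r ^' sum w)

    weightSum-filterᵇ : ∀ P xs → weightSum p q r (filterᵇ P xs) ≈ sumList (λ x → weight x * ⟦ P x ⟧) xs
    weightSum-filterᵇ P []       = refl
    weightSum-filterᵇ P (x ∷ xs) with P x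
    ... | true  = +-cong (sym (*-identityʳ _)) (weightSum-filterᵇ P xs)
    ... | false = trans (weightSum-filterᵇ P xs) (sym (trans (+-congʳ (zeroʳ _)) (+-identityˡ _)))

    weight-∷ : ∀ {n c u σ w} → c ≤ n → σ ↭ applyDownFrom suc n →
      weight (suc c ∷ map (skip (suc c)) σ , u ∷ w) ≈ (ω p q n c * (r ^' u)) * weight (σ , w)
    weight-∷ {n} {c} {u} {σ} {w} c≤n h = begin
      (q ^' inv (suc c ∷ map (skip (suc c)) σ)) * (p ^' coinv (suc c ∷ map (skip (suc c)) σ)) * (r ^' (u ℕ.+ sum w))
        ≡⟨ cong₂ (λ i j → (q ^' i) * (p ^' j) * (r ^' (u ℕ.+ sum w))) (inv-∷-skip c≤n h) (coinv-∷-skip c≤n h) ⟩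
      (q ^' (c ℕ.+ inv σ)) * (p ^' (n ∸ c ℕ.+ coinv σ)) * (r ^' (u ℕ.+ sum w))
        ≈⟨ *-cong (*-cong (^'-+ q c _) (^'-+ p (n ∸ c) _)) (^'-+ r u _) ⟩
      ((q ^' c) * (q ^' inv σ)) * ((p ^' (n ∸ c)) * (p ^' coinv σ)) * ((r ^' u) * (r ^' sum w))
        ≈⟨ solve 6 (λ a b c d e f → (a :* b) :* (c :* d) :* (e :* f) := ((a :* c) :* e) :* (b :* d :* f)) refl _ _ _ _ _ _ ⟩
      (ω p q n c * (r ^' u)) * weight (σ , w) ∎

    weighted-suc : ∀ n (F : List ℕ × List ℕ → Carrier) →
      sumList (λ x → weight x * F x) (wreath (suc n) k) ≈
      sumBelow (suc n) (λ c → sumBelow k (λ u → (ω p q n c * (r ^' u)) *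
        sumList (λ (τ , w) → weight (τ , w) * F (suc c ∷ map (skip (suc c)) τ , u ∷ w)) (wreath n k)))
    weighted-suc n F = trans (sumList-wreath-suc k n _)
      (sumBelow-cong< (suc n) λ { c (s≤s c≤n) → sumBelow-cong k λ u → trans
        (sumList-congAll (All.map (λ { {_ , w} h → trans (*-congʳ (weight-∷ {u = u} {w = w} c≤n h)) (*-assoc _ _ _) }) (wreath-↭ k n)))
        (sumList-*ˡ (ω p q n c * (r ^' u)) _ (wreath n k)) })

    riseSum : ℕ → (List Bool → Carrier) → Carrier
    riseSum n Φ = sumList (λ (σ , w) → weight (σ , w) * Φ (rises σ w)) (wreath n k)

    -- The preceding letter enters only through its Lehmer digit `c` and its colour `u`; by
    -- `rises-∷-skip` that determines the junction bit.
    riseSumFrom : ℕ → (List Bool → Carrier) → ℕ → ℕ → Carrier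
    riseSumFrom n Φ c u = sumList (λ (σ , w) → weight (σ , w) * Φ (rises (c ∷ σ) (u ∷ w))) (wreath n k)

    riseSum-suc : ∀ n Φ → riseSum (suc n) Φ ≈
      sumBelow (suc n) (λ c → sumBelow k (λ u → (ω p q n c * (r ^' u)) * riseSumFrom n Φ c u))
    riseSum-suc n Φ = trans (weighted-suc n _)
      (sumBelow-cong (suc n) λ c → sumBelow-cong k λ u → *-congˡ (sumList-cong
        (λ (σ , w) → *-congˡ (reflexive (cong Φ (rises-∷-skip c σ (u ∷ w))))) (wreath n k)))

    -- The first letter of the block is already fixed as `(c , u)`. Each of the other `l` letters
    -- must repeat the colour `u`, contributing `r ^' u`, and must have a digit no smaller than the
    -- one before. Behind the block, `block 1` drops the junction bit, so neither `c` nor `u`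
    -- affects the rest.
    riseSumFrom-block : ∀ l m Φ c u → u < k →
      riseSumFrom (l ℕ.+ m) (block (suc l) Φ) c u ≈ ((r ^' u) ^' l * chains p q l m c) * riseSum m Φ
    riseSumFrom-block zero m Φ c u u<k = trans
      (sumList-cong (λ (σ , w) → *-congˡ (block-1 σ w)) (wreath m k))
      (sym (trans (*-congʳ (*-identityˡ 1#)) (*-identityˡ _)))
      where
      block-1 : ∀ σ w → block 1 Φ (rises (c ∷ σ) (u ∷ w)) ≈ Φ (rises σ w)
      block-1 []          w           = refl
      block-1 (a ∷ [])    []          = refl
      block-1 (a ∷ b ∷ σ) []          = refl
      block-1 (a ∷ σ)     (v ∷ w)     = refl
    riseSumFrom-block (suc l) m Φ c u u<k = begin
      riseSumFrom (suc n) (block (2 ℕ.+ l) Φ) c u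
        ≈⟨ weighted-suc n _ ⟩
      sumBelow (suc n) (λ c′ → sumBelow k (λ u′ → (ω p q n c′ * (r ^' u′)) *
        sumList (λ (σ , w) → weight (σ , w) * (⟦ (c <ᵇ suc c′) ∧ (u ≡ᵇ u′) ⟧ *
          block (suc l) Φ (rises (suc c′ ∷ map (skip (suc c′)) σ) (u′ ∷ w)))) (wreath n k)))
        ≈⟨ (sumBelow-cong (suc n) λ c′ → sumBelow-cong k λ u′ → trans (*-congˡ (trans
              (sumList-cong (λ (σ , w) → trans (*-congˡ (*-cong (⟦⟧-∧ (c <ᵇ suc c′) (u ≡ᵇ u′))
                 (reflexive (cong (block (suc l) Φ) (rises-∷-skip c′ σ (u′ ∷ w))))))
                 (solve 4 (λ a b c d → a :* (b :* c :* d) := (b :* c) :* (a :* d)) refl _ _ _ _)) (wreath n k))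
              (sumList-*ˡ (⟦ c <ᵇ suc c′ ⟧ * ⟦ u ≡ᵇ u′ ⟧) _ (wreath n k))))
            (solve 5 (λ a b c d e → (a :* b) :* ((c :* d) :* e) := (c :* a) :* (d :* (b :* e))) refl _ _ _ _ _)) ⟩
      sumBelow (suc n) (λ c′ → sumBelow k (λ u′ → (⟦ c <ᵇ suc c′ ⟧ * ω p q n c′) *
        (⟦ u ≡ᵇ u′ ⟧ * ((r ^' u′) * riseSumFrom n (block (suc l) Φ) c′ u′))))
        -- A rise forces equal colours, so the sum over `u′` collapses to `u′ = u`; this term occurs
        -- since `u < k`.
        ≈⟨ (sumBelow-cong (suc n) λ c′ → trans (sumBelow-*ˡ k _ _) (*-congˡ (sumBelow-≡ᵇ k u _ u<k))) ⟩
      sumBelow (suc n) (λ c′ → (⟦ c <ᵇ suc c′ ⟧ * ω p q n c′) * ((r ^' u) * riseSumFrom n (block (suc l) Φ) c′ u))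
        ≈⟨ (sumBelow-cong (suc n) λ c′ → trans (*-congˡ (*-congˡ (riseSumFrom-block l m Φ c′ u u<k)))
             (solve 6 (λ a b c d e f → (a :* b) :* (c :* ((d :* e) :* f)) := ((c :* d) :* f) :* (a :* (b :* e))) refl _ _ _ _ _ _)) ⟩
      sumBelow (suc n) (λ c′ → ((r ^' u) * (r ^' u) ^' l * riseSum m Φ) * (⟦ c <ᵇ suc c′ ⟧ * (ω p q n c′ * chains p q l m c′)))
        ≈⟨ sumBelow-*ˡ (suc n) _ _ ⟩
      ((r ^' u) * (r ^' u) ^' l * riseSum m Φ) * chains p q (suc l) m c
        ≈⟨ solve 3 (λ a b c → (a :* b) :* c := (a :* c) :* b) refl _ _ _ ⟩
      ((r ^' u) ^' suc l * chains p q (suc l) m c) * riseSum m Φ ∎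
      where
      n : ℕ
      n = l ℕ.+ m

    riseSum-block : ∀ l m Φ → riseSum (suc (l ℕ.+ m)) (block (suc l) Φ) ≈
      (kInt k (r ^' suc l) * chains p q (suc l) m 0) * riseSum m Φ
    riseSum-block l m Φ = begin
      riseSum (suc n) (block (suc l) Φ)
        ≈⟨ riseSum-suc n (block (suc l) Φ) ⟩
      sumBelow (suc n) (λ c → sumBelow k (λ u → (ω p q n c * (r ^' u)) * riseSumFrom n (block (suc l) Φ) c u))
        -- Writing the powers of r as `(r ^' suc l) ^' u` makes the sum over colours the integer [k]
        -- at r^(l+1).
        ≈⟨ (sumBelow-cong (suc n) λ c → sumBelow-cong< k λ u u<k → trans (*-congˡ (riseSumFrom-block l m Φ c u u<k))
             (trans (solve 5 (λ a b c d e → (a :* b) :* ((c :* d) :* e) := (a :* d :* e) :* (b :* c)) refl _ _ _ _ _)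
                    (*-congˡ (^'-comm r u (suc l))))) ⟩
      sumBelow (suc n) (λ c → sumBelow k (λ u → (ω p q n c * chains p q l m c * riseSum m Φ) * ((r ^' suc l) ^' u)))
        -- The inserted `1#` is the value of `⟦ 0 <ᵇ suc c ⟧`, which turns the sum over `c` into the
        -- defining sum of `chains` with lower bound 0.
        ≈⟨ (sumBelow-cong (suc n) λ c → trans (sumBelow-*ˡ k _ _)
             (trans (solve 3 (λ a b c → (a :* b) :* c := (c :* b) :* a) refl _ _ _) (*-congˡ (sym (*-identityˡ _))))) ⟩
      sumBelow (suc n) (λ c → (kInt k (r ^' suc l) * riseSum m Φ) * (1# * (ω p q n c * chains p q l m c)))
        ≈⟨ sumBelow-*ˡ (suc n) _ _ ⟩
      (kInt k (r ^' suc l) * riseSum m Φ) * chains p q (suc l) m 0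
        ≈⟨ solve 3 (λ a b c → (a :* b) :* c := (a :* c) :* b) refl _ _ _ ⟩
      (kInt k (r ^' suc l) * chains p q (suc l) m 0) * riseSum m Φ ∎
      where
      n : ℕ
      n = l ℕ.+ m

    riseSum-blocks : ∀ n y Φ → riseSum (suc n) (blocks y Φ) ≈
      sumBelow (suc n) (λ i → y i * riseSum (suc n) (block (suc i) Φ))
    riseSum-blocks n y Φ = begin
      riseSum (suc n) (blocks y Φ)
        ≈⟨ sumList-congAll (All.map
             (λ { {σ , w} h → *-congˡ (blocks≈sumBelow n y Φ (rises σ w) (short σ w h)) }) (wreath-↭ k (suc n))) ⟩
      sumList (λ (σ , w) → weight (σ , w) * sumBelow (suc n) (λ i → y i * block (suc i) Φ (rises σ w))) (wreath (suc n) k)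
        ≈⟨ sumList-cong (λ x → trans (sym (sumBelow-*ˡ (suc n) _ _)) (sumBelow-cong (suc n) λ i →
             solve 3 (λ a b c → a :* (b :* c) := b :* (a :* c)) refl _ _ _)) (wreath (suc n) k) ⟩
      sumList (λ (σ , w) → sumBelow (suc n) (λ i → y i * (weight (σ , w) * block (suc i) Φ (rises σ w)))) (wreath (suc n) k)
        ≈⟨ sumList-sumBelow (suc n) _ (wreath (suc n) k) ⟩
      sumBelow (suc n) (λ i → sumList (λ (σ , w) → y i * (weight (σ , w) * block (suc i) Φ (rises σ w))) (wreath (suc n) k))
        ≈⟨ (sumBelow-cong (suc n) λ i → sumList-*ˡ (y i) _ (wreath (suc n) k)) ⟩
      sumBelow (suc n) (λ i → y i * riseSum (suc n) (block (suc i) Φ)) ∎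
      where
      short : ∀ σ w → σ ↭ applyDownFrom suc (suc n) → length (rises σ w) ≤ n
      short [] w h = z≤n
      short (a ∷ σ) w h = ℕ.≤-trans (length-rises a σ w)
        (ℕ.≤-pred (ℕ.≤-reflexive (≡.trans (↭-length h) (length-applyDownFrom suc (suc n)))))

  -- The commutative ring of formal power series.

  1ₛ : Series
  1ₛ zero    = 1#
  1ₛ (suc n) = 0#

  ⊛-front : ∀ f g n → (f ⊛ g) (suc n) ≈ f 0 * g (suc n) + ((λ i → f (suc i)) ⊛ g) n
  ⊛-front f g n = sumBelow-front (suc n) _

  ⊛-back : ∀ f g n → (f ⊛ g) (suc n) ≈ (f ⊛ (λ i → g (suc i))) n + f (suc n) * g 0
  ⊛-back f g n = +-cong
    (sumBelow-cong< (suc n) λ { i (s≤s i≤n) → *-congˡ (reflexive (cong g (ℕ.+-∸-assoc 1 i≤n))) })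
    (*-congˡ (reflexive (cong g (ℕ.n∸n≡0 n))))

  ⊛-cong : ∀ {f f′ g g′} → f ≋ f′ → g ≋ g′ → f ⊛ g ≋ f′ ⊛ g′
  ⊛-cong h h′ n = sumBelow-cong (suc n) λ i → *-cong (h i) (h′ (n ∸ i))

  ⊛-distribʳ : ∀ h f g → (f ⊕ g) ⊛ h ≋ f ⊛ h ⊕ g ⊛ h
  ⊛-distribʳ h f g n = trans (sumBelow-cong (suc n) λ i → distribʳ _ _ _) (sumBelow-+ (suc n) _ _)

  ⊛-scale : ∀ a f g n → ((λ i → a * f i) ⊛ g) n ≈ a * (f ⊛ g) n
  ⊛-scale a f g n = trans (sumBelow-cong (suc n) λ i → *-assoc _ _ _) (sumBelow-*ˡ (suc n) a _)

  -- Splitting off the first summand on one side and the last on the other leaves products of `g`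
  -- with the shifted `f`, which the induction hypothesis exchanges.
  ⊛-comm : ∀ f g → f ⊛ g ≋ g ⊛ f
  ⊛-comm f g zero    = +-congˡ (*-comm _ _)
  ⊛-comm f g (suc n) = begin
    (f ⊛ g) (suc n)                                  ≈⟨ ⊛-front f g n ⟩
    f 0 * g (suc n) + ((λ i → f (suc i)) ⊛ g) n      ≈⟨ +-cong (*-comm _ _) (⊛-comm _ g n) ⟩
    g (suc n) * f 0 + (g ⊛ (λ i → f (suc i))) n      ≈⟨ +-comm _ _ ⟩
    (g ⊛ (λ i → f (suc i))) n + g (suc n) * f 0      ≈⟨ ⊛-back g f n ⟨
    (g ⊛ f) (suc n)                                  ∎

  ⊛-assoc : ∀ f g h → (f ⊛ g) ⊛ h ≋ f ⊛ (g ⊛ h)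
  ⊛-assoc f g h zero    = +-congˡ (trans (*-congʳ (+-identityˡ _)) (trans (*-assoc _ _ _) (*-congˡ (sym (+-identityˡ _)))))
  ⊛-assoc f g h (suc n) = begin
    ((f ⊛ g) ⊛ h) (suc n)
      ≈⟨ ⊛-front (f ⊛ g) h n ⟩
    (f ⊛ g) 0 * h (suc n) + ((λ i → (f ⊛ g) (suc i)) ⊛ h) n
      ≈⟨ +-cong (trans (*-congʳ (+-identityˡ _)) (*-assoc _ _ _))
           (trans (⊛-cong {g = h} (⊛-front f g) (λ _ → refl) n)
             (⊛-distribʳ h (λ i → f 0 * g (suc i)) ((λ i → f (suc i)) ⊛ g) n)) ⟩
    f 0 * (g 0 * h (suc n)) + (((λ i → f 0 * g (suc i)) ⊛ h) n + (((λ i → f (suc i)) ⊛ g) ⊛ h) n)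
      ≈⟨ +-congˡ (+-cong (⊛-scale (f 0) (λ i → g (suc i)) h n) (⊛-assoc (λ i → f (suc i)) g h n)) ⟩
    f 0 * (g 0 * h (suc n)) + (f 0 * ((λ i → g (suc i)) ⊛ h) n + ((λ i → f (suc i)) ⊛ (g ⊛ h)) n)
      ≈⟨ solve 4 (λ a b c d → a :* b :+ (a :* c :+ d) := a :* (b :+ c) :+ d) refl _ _ _ _ ⟩
    f 0 * (g 0 * h (suc n) + ((λ i → g (suc i)) ⊛ h) n) + ((λ i → f (suc i)) ⊛ (g ⊛ h)) n
      ≈⟨ +-congʳ (*-congˡ (⊛-front g h n)) ⟨
    f 0 * (g ⊛ h) (suc n) + ((λ i → f (suc i)) ⊛ (g ⊛ h)) n
      ≈⟨ ⊛-front f (g ⊛ h) n ⟨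
    (f ⊛ (g ⊛ h)) (suc n) ∎

  ⊛-identityˡ : ∀ f → 1ₛ ⊛ f ≋ f
  ⊛-identityˡ f n = trans (sumBelow-front n _) (trans (+-cong (*-identityˡ _)
    (trans (sumBelow-cong n λ i → zeroˡ _) (sumBelow-0 n))) (+-identityʳ _))

  ⊛-identityʳ : ∀ f → f ⊛ 1ₛ ≋ f
  ⊛-identityʳ f n = trans (⊛-comm f 1ₛ n) (⊛-identityˡ f n)

  ⊛-distribˡ : ∀ h f g → h ⊛ (f ⊕ g) ≋ h ⊛ f ⊕ h ⊛ g
  ⊛-distribˡ h f g n = trans (⊛-comm h (f ⊕ g) n)
    (trans (⊛-distribʳ h f g n) (+-cong (⊛-comm f h n) (⊛-comm g h n)))

  seriesRing : CommutativeRing _ _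
  seriesRing = record
    { Carrier = Series
    ; _≈_     = _≋_
    ; _+_     = _⊕_
    ; _*_     = _⊛_
    ; -_      = λ f n → - f n
    ; 0#      = λ _ → 0#
    ; 1#      = 1ₛ
    ; isCommutativeRing = record
      { isRing = record
        { +-isAbelianGroup = Pointwise.isAbelianGroup +-isAbelianGroup
        ; *-cong           = λ {f} {f′} {g} {g′} → ⊛-cong {f} {f′} {g} {g′}
        ; *-assoc          = ⊛-assoc
        ; *-identity       = ⊛-identityˡ , ⊛-identityʳ
        ; distrib          = ⊛-distribˡ , ⊛-distribʳ
        }
      ; *-comm = ⊛-comm
      }
    }

  -- Linearity of `blocks` in its coefficients, and finite differences of the signed coefficients.

  blocks-cong : ∀ {y z} Φ β → (∀ i → y i ≈ z i) → blocks y Φ β ≈ blocks z Φ β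
  blocks-cong Φ []      h = *-congʳ (h 0)
  blocks-cong Φ (b ∷ β) h = +-cong (*-congʳ (h 0)) (*-congˡ (blocks-cong Φ β (λ i → h (suc i))))

  blocks-+ : ∀ y z Φ β → blocks (λ i → y i + z i) Φ β ≈ blocks y Φ β + blocks z Φ β
  blocks-+ y z Φ []      = distribʳ _ _ _
  blocks-+ y z Φ (b ∷ β) = trans (+-congˡ (*-congˡ (blocks-+ (λ i → y (suc i)) (λ i → z (suc i)) Φ β)))
    (solve 6 (λ a b c d e f → (a :+ b) :* c :+ d :* (e :+ f) := (a :* c :+ d :* e) :+ (b :* c :+ d :* f)) refl _ _ _ _ _ _)

  blocks-0 : ∀ Φ β → blocks (λ _ → 0#) Φ β ≈ 0#
  blocks-0 Φ []      = zeroˡ _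
  blocks-0 Φ (b ∷ β) = trans (+-cong (zeroˡ _) (trans (*-congˡ (blocks-0 Φ β)) (zeroʳ _))) (+-identityˡ _)

  natMul-cong : ∀ n {a b} → a ≈ b → natMul n a ≈ natMul n b
  natMul-cong zero    h = refl
  natMul-cong (suc n) h = +-cong h (natMul-cong n h)

  natMul-+ˡ : ∀ m n a → natMul (m ℕ.+ n) a ≈ natMul m a + natMul n a
  natMul-+ˡ zero    n a = sym (+-identityˡ _)
  natMul-+ˡ (suc m) n a = trans (+-congˡ (natMul-+ˡ m n a)) (sym (+-assoc _ _ _))

  natMul-* : ∀ n a b → natMul n (a * b) ≈ natMul n a * b
  natMul-* zero    a b = sym (zeroˡ b)
  natMul-* (suc n) a b = trans (+-congˡ (natMul-* n a b)) (sym (distribʳ b _ _))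

  natMul-neg : ∀ n a → natMul n (- a) ≈ - natMul n a
  natMul-neg zero    a = sym -0#≈0#
  natMul-neg (suc n) a = trans (+-congˡ (natMul-neg n a)) (-‿+-comm a (natMul n a))

  sign : ℕ → Carrier
  sign i = (- 1#) ^' suc i

  sign-suc : ∀ i → sign (suc i) ≈ - sign i
  sign-suc i = -1*x≈-x (sign i)

  1+sign0 : 1# + sign 0 ≈ 0#
  1+sign0 = trans (+-congˡ (*-identityʳ _)) (-‿inverseʳ 1#)

  -- The coefficients of P, G, H and [k]_r t − 1 + P − G, without the common factor
  -- p^(n C 2) [k]_{r^n} / [n]!, at n = i + 1.
  signG signH signQ : ℕ → Carrier
  signG i = natMul i (sign i)
  signH i = - natMul (i C 2) (sign i)
  signQ zero    = 0#
  signQ (suc i) = - natMul i (sign (suc i))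

  natMul-sign-suc : ∀ n i → natMul n (sign (suc i)) ≈ - natMul n (sign i)
  natMul-sign-suc n i = trans (natMul-cong n (sign-suc i)) (natMul-neg n (sign i))

  -- Because the signs alternate, adding neighbouring coefficients amounts to taking a finite
  -- difference: 0 for the constant sequence here, a constant for `signG`, and, by Pascal's rule,
  -- `signG` itself for `signH`.
  sign-pair : ∀ i → sign i + sign (suc i) ≈ 0#
  sign-pair i = trans (+-congˡ (sign-suc i)) (-‿inverseʳ _)

  signG-step : ∀ i → signG (suc i) + (signG i + sign i) ≈ 0#
  signG-step i = begin
    (sign (suc i) + natMul i (sign (suc i))) + (natMul i (sign i) + sign i)
      ≈⟨ +-cong (+-cong (sign-suc i) (natMul-sign-suc i i)) (+-comm _ _) ⟩
    (- sign i + - natMul i (sign i)) + (sign i + natMul i (sign i))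
      ≈⟨ +-congʳ (-‿+-comm _ _) ⟩
    - (sign i + natMul i (sign i)) + (sign i + natMul i (sign i))
      ≈⟨ -‿inverseˡ _ ⟩
    0# ∎

  signH-step : ∀ i → signH (suc i) + signH i ≈ signG i
  signH-step i = begin
    - natMul (suc i C 2) (sign (suc i)) + signH i
      ≈⟨ +-congʳ (-‿cong (natMul-sign-suc (suc i C 2) i)) ⟩
    - - natMul (suc i C 2) (sign i) + signH i
      ≈⟨ +-congʳ (-‿involutive _) ⟩
    natMul (suc i C 2) (sign i) + signH i
      ≡⟨ cong (λ n → natMul n (sign i) + signH i)
           (≡.trans (≡.sym (nCk+nC[k+1]≡[n+1]C[k+1] i 1)) (cong (ℕ._+ i C 2) (nC1≡n i))) ⟩
    natMul (i ℕ.+ i C 2) (sign i) + signH i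
      ≈⟨ +-congʳ (natMul-+ˡ i (i C 2) (sign i)) ⟩
    (natMul i (sign i) + natMul (i C 2) (sign i)) + signH i
      ≈⟨ trans (+-assoc _ _ _) (trans (+-congˡ (-‿inverseʳ _)) (+-identityʳ _)) ⟩
    signG i ∎

  signQ-step : ∀ i → signQ (2 ℕ.+ i) + signQ (suc i) ≈ sign (suc i)
  signQ-step i = begin
    - natMul (suc i) (sign (2 ℕ.+ i)) + - natMul i (sign (suc i))
      ≈⟨ +-congʳ (trans (-‿cong (natMul-sign-suc (suc i) (suc i))) (-‿involutive _)) ⟩
    (sign (suc i) + natMul i (sign (suc i))) + - natMul i (sign (suc i))
      ≈⟨ trans (+-assoc _ _ _) (trans (+-congˡ (-‿inverseʳ _)) (+-identityʳ _)) ⟩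
    sign (suc i) ∎

  -- Identities between functions of bit lists.

  noRise oneRise twoRises adjacentNext twoAdjacent : List Bool → Carrier
  noRise []          = 1#
  noRise (true ∷ β)  = 0#
  noRise (false ∷ β) = noRise β
  oneRise []          = 0#
  oneRise (true ∷ β)  = noRise β
  oneRise (false ∷ β) = oneRise β
  twoRises []          = 0#
  twoRises (true ∷ β)  = oneRise β
  twoRises (false ∷ β) = twoRises β
  adjacentNext []          = 0#
  adjacentNext (true ∷ β)  = noRise β
  adjacentNext (false ∷ β) = 0#
  twoAdjacent []          = 0#
  twoAdjacent (true ∷ β)  = adjacentNext β
  twoAdjacent (false ∷ β) = twoAdjacent β

  blocks-sign-pair : ∀ Φ β → blocks sign Φ β + blocks (λ i → sign (suc i)) Φ β ≈ 0#
  blocks-sign-pair Φ β = trans (sym (blocks-+ _ _ Φ β)) (trans (blocks-cong Φ β sign-pair) (blocks-0 Φ β))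

  blocks-signG-step : ∀ Φ β → blocks (λ i → signG (suc i)) Φ β + (blocks signG Φ β + blocks sign Φ β) ≈ 0#
  blocks-signG-step Φ β = trans (+-congˡ (sym (blocks-+ signG sign Φ β)))
    (trans (sym (blocks-+ _ _ Φ β)) (trans (blocks-cong Φ β signG-step) (blocks-0 Φ β)))

  x+sign0*x : ∀ x → x + sign 0 * x ≈ 0#
  x+sign0*x x = trans (+-congʳ (sym (*-identityˡ x)))
    (trans (sym (distribʳ x 1# (sign 0))) (trans (*-congʳ 1+sign0) (zeroˡ x)))

  -- `x` is the value on the tail. A leading `false` does not change the statistic, a one-letter
  -- block with coefficient -1 cancels it, and every longer block would need a rise at this bit.
  false-step : ∀ x z → x + (sign 0 * x + 0# * z) ≈ 0#
  false-step x z = trans (+-congˡ (trans (+-congˡ (zeroˡ z)) (+-identityʳ _))) (x+sign0*x x)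

  x*0+0*y : ∀ {x y z} → x ≈ 0# → x * y + 0# * z ≈ 0#
  x*0+0*y h = trans (+-cong (trans (*-congʳ h) (zeroˡ _)) (zeroˡ _)) (+-identityˡ _)

  -- The pattern form of P N₀ = 1 in positive degrees: the first summand comes from the constant
  -- term 1 of P.
  noRise-blocks : ∀ β → noRise β + blocks sign noRise β ≈ 0#
  noRise-blocks []          = x+sign0*x 1#
  noRise-blocks (false ∷ β) = false-step (noRise β) _
  -- The cancelled summand is the induction hypothesis, equal to 0; it supplies the unshifted `B`
  -- that annihilates `B′`.
  noRise-blocks (true ∷ β)  = +-cancelʳ (noRise β + B) _ _ (begin
    (0# + (sign 0 * noRise β + 1# * B′)) + (noRise β + B)
      ≈⟨ solve 4 (λ n x b b′ → (con 0 :+ (x :+ con 1 :* b′)) :+ (n :+ b) := (n :+ x) :+ (b :+ b′)) refl _ _ _ _ ⟩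
    (noRise β + sign 0 * noRise β) + (B + B′)
      ≈⟨ +-cong (x+sign0*x _) (blocks-sign-pair noRise β) ⟩
    0# + 0#
      ≈⟨ +-congˡ (noRise-blocks β) ⟨
    0# + (noRise β + B) ∎)
    where
    B B′ : Carrier
    B  = blocks sign noRise β
    B′ = blocks (λ i → sign (suc i)) noRise β

  oneRise-blocks : ∀ β → oneRise β + blocks sign oneRise β ≈ blocks signG noRise β
  oneRise-blocks []          = trans (x+sign0*x 0#) (sym (zeroˡ _))
  oneRise-blocks (false ∷ β) = trans (false-step (oneRise β) _) (sym (x*0+0*y refl))
  -- `G₀ + B₀` is chosen so that the right side becomes `G₀′ + (G₀ + B₀)`, which is 0 by
  -- `signG-step`. On the left, the induction hypothesis and `noRise-blocks` give 0 as well.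
  oneRise-blocks (true ∷ β)  = +-cancelʳ (G₀ + B₀) _ _ (begin
    (noRise β + (sign 0 * oneRise β + 1# * B₁′)) + (G₀ + B₀)
      ≈⟨ +-congˡ (+-congʳ (oneRise-blocks β)) ⟨
    (noRise β + (sign 0 * oneRise β + 1# * B₁′)) + ((oneRise β + B₁) + B₀)
      ≈⟨ solve 6 (λ n x b′ m b c → (n :+ (x :+ con 1 :* b′)) :+ ((m :+ b) :+ c) :=
           (n :+ c) :+ ((m :+ x) :+ (b :+ b′))) refl _ _ _ _ _ _ ⟩
    (noRise β + B₀) + ((oneRise β + sign 0 * oneRise β) + (B₁ + B₁′))
      ≈⟨ +-cong (noRise-blocks β) (+-cong (x+sign0*x _) (blocks-sign-pair oneRise β)) ⟩
    0# + (0# + 0#)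
      ≈⟨ trans (+-identityˡ _) (+-identityˡ _) ⟩
    0#
      ≈⟨ blocks-signG-step noRise β ⟨
    G₀′ + (G₀ + B₀)
      ≈⟨ +-congʳ (solve 2 (λ n g → con 0 :* n :+ con 1 :* g := g) refl _ _) ⟨
    (0# * noRise β + 1# * G₀′) + (G₀ + B₀) ∎)
    where
    B₀ B₁ B₁′ G₀ G₀′ : Carrier
    B₀  = blocks sign noRise β
    B₁  = blocks sign oneRise β
    B₁′ = blocks (λ i → sign (suc i)) oneRise β
    G₀  = blocks signG noRise β
    G₀′ = blocks (λ i → signG (suc i)) noRise β

  twoRises-blocks : ∀ β → twoRises β + blocks sign twoRises β ≈ blocks signG oneRise β + blocks signH noRise β
  twoRises-blocks []          = trans (x+sign0*x 0#)
    (sym (trans (+-cong (zeroˡ _) (trans (*-congʳ -0#≈0#) (zeroˡ _))) (+-identityˡ _)))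
  twoRises-blocks (false ∷ β) = trans (false-step (twoRises β) _)
    (sym (trans (+-cong (x*0+0*y refl) (x*0+0*y -0#≈0#)) (+-identityˡ _)))
  -- With this summand both sides collapse to `G₀`: the left by `oneRise-blocks`, the right because
  -- Pascal's rule turns `H₀′ + H₀` into `G₀` while the terms with `G₁` add up to 0.
  twoRises-blocks (true ∷ β)  = +-cancelʳ ((G₁ + H₀) + B₁) _ _ (begin
    (oneRise β + (sign 0 * twoRises β + 1# * B₂′)) + ((G₁ + H₀) + B₁)
      ≈⟨ +-congˡ (+-congʳ (twoRises-blocks β)) ⟨
    (oneRise β + (sign 0 * twoRises β + 1# * B₂′)) + ((twoRises β + B₂) + B₁)
      ≈⟨ solve 6 (λ n x b′ m b c → (n :+ (x :+ con 1 :* b′)) :+ ((m :+ b) :+ c) :=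
           (n :+ c) :+ ((m :+ x) :+ (b :+ b′))) refl _ _ _ _ _ _ ⟩
    (oneRise β + B₁) + ((twoRises β + sign 0 * twoRises β) + (B₂ + B₂′))
      ≈⟨ +-cong (oneRise-blocks β) (trans (+-cong (x+sign0*x _) (blocks-sign-pair twoRises β)) (+-identityˡ _)) ⟩
    G₀ + 0#
      ≈⟨ +-cong (blocks-signH-step) (blocks-signG-step oneRise β) ⟨
    (H₀′ + H₀) + (G₁′ + (G₁ + B₁))
      ≈⟨ solve 6 (λ h′ h g′ g b n → (h′ :+ h) :+ (g′ :+ (g :+ b)) :=
           (con 0 :* n :+ con 1 :* g′) :+ (con 0 :+ con 1 :* h′) :+ ((g :+ h) :+ b)) refl _ _ _ _ _ _ ⟩
    ((0# * oneRise β + 1# * G₁′) + (0# + 1# * H₀′)) + ((G₁ + H₀) + B₁)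
      -- `- 0#` is what `signH 0` computes to.
      ≈⟨ +-congʳ (+-congˡ (+-congʳ (trans (*-congʳ -0#≈0#) (zeroˡ _)))) ⟨
    ((0# * oneRise β + 1# * G₁′) + ((- 0#) * noRise β + 1# * H₀′)) + ((G₁ + H₀) + B₁) ∎)
    where
    B₁ B₂ B₂′ G₀ G₁ G₁′ H₀ H₀′ : Carrier
    B₁  = blocks sign oneRise β
    B₂  = blocks sign twoRises β
    B₂′ = blocks (λ i → sign (suc i)) twoRises β
    G₀  = blocks signG noRise β
    G₁  = blocks signG oneRise β
    G₁′ = blocks (λ i → signG (suc i)) oneRise β
    H₀  = blocks signH noRise β
    H₀′ = blocks (λ i → signH (suc i)) noRise β
    blocks-signH-step : H₀′ + H₀ ≈ G₀
    blocks-signH-step = trans (sym (blocks-+ _ _ noRise β)) (blocks-cong noRise β signH-step)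

  -- Adding neighbours turns `signQ` into 0, `sign 1`, `sign 2`, .... The leading 0 excludes
  -- one-letter blocks, so the first bit must be a rise; behind it stands the shifted `sign`, the
  -- negative of `sign`, and `blocks sign noRise` is itself the negative of `noRise`.
  blocks-signQ-step : ∀ β → blocks (λ i → signQ (suc i)) noRise β + blocks signQ noRise β ≈ adjacentNext β
  blocks-signQ-step β = trans (sym (blocks-+ _ _ noRise β)) (lemma β)
    where
    signQ-base : signQ 1 + signQ 0 ≈ 0#
    signQ-base = trans (+-identityʳ _) -0#≈0#
    lemma : ∀ β → blocks (λ i → signQ (suc i) + signQ i) noRise β ≈ adjacentNext β
    lemma []          = trans (*-congʳ signQ-base) (zeroˡ _)
    lemma (false ∷ β) = x*0+0*y signQ-base
    lemma (true ∷ β)  = begin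
      (signQ 1 + signQ 0) * noRise β + 1# * blocks (λ i → signQ (2 ℕ.+ i) + signQ (suc i)) noRise β
        ≈⟨ +-cong (trans (*-congʳ signQ-base) (zeroˡ _)) (trans (*-identityˡ _) (blocks-cong noRise β signQ-step)) ⟩
      0# + blocks (λ i → sign (suc i)) noRise β
        ≈⟨ +-identityˡ _ ⟩
      blocks (λ i → sign (suc i)) noRise β
        ≈⟨ +-cancelˡ (blocks sign noRise β) _ _ (trans (blocks-sign-pair noRise β)
             (sym (trans (+-comm _ _) (noRise-blocks β)))) ⟩
      noRise β ∎

  twoAdjacent-blocks : ∀ β → twoAdjacent β + blocks sign twoAdjacent β ≈ blocks signQ noRise β
  twoAdjacent-blocks []          = trans (x+sign0*x 0#) (sym (zeroˡ _))
  twoAdjacent-blocks (false ∷ β) = trans (false-step (twoAdjacent β) _) (sym (x*0+0*y refl))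
  twoAdjacent-blocks (true ∷ β)  = +-cancelʳ Q _ _ (begin
    (adjacentNext β + (sign 0 * twoAdjacent β + 1# * B′)) + Q
      ≈⟨ +-congˡ (twoAdjacent-blocks β) ⟨
    (adjacentNext β + (sign 0 * twoAdjacent β + 1# * B′)) + (twoAdjacent β + B)
      ≈⟨ solve 5 (λ n x b′ m b → (n :+ (x :+ con 1 :* b′)) :+ (m :+ b) := n :+ ((m :+ x) :+ (b :+ b′))) refl _ _ _ _ _ ⟩
    adjacentNext β + ((twoAdjacent β + sign 0 * twoAdjacent β) + (B + B′))
      ≈⟨ +-congˡ (trans (+-cong (x+sign0*x _) (blocks-sign-pair twoAdjacent β)) (+-identityˡ _)) ⟩
    adjacentNext β + 0#
      ≈⟨ trans (+-identityʳ _) (sym (blocks-signQ-step β)) ⟩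
    Q′ + Q
      ≈⟨ +-congʳ (solve 2 (λ n g → con 0 :* n :+ con 1 :* g := g) refl _ _) ⟨
    (0# * noRise β + 1# * Q′) + Q ∎)
    where
    B B′ Q Q′ : Carrier
    B  = blocks sign twoAdjacent β
    B′ = blocks (λ i → sign (suc i)) twoAdjacent β
    Q  = blocks signQ noRise β
    Q′ = blocks (λ i → signQ (suc i)) noRise β

  -- From positions of rises to statistics of bit lists.

  isU-∷∷ : ∀ i j l β → ⟦ isU (i ∷ j ∷ positions l β) ⟧ ≈ ⟦ j ≡ᵇ suc i ⟧ * noRise β
  isU-∷∷ i j l []          = sym (*-identityʳ _)
  isU-∷∷ i j l (true ∷ β)  = sym (zeroʳ _)
  isU-∷∷ i j l (false ∷ β) = isU-∷∷ i j (suc l) β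

  -- Any further rise would be a third position, hence `noRise`. The test `suc (suc i) ≤ᵇ j` unfolds
  -- to `suc i <ᵇ j`.
  isV-∷∷ : ∀ i j l β → ⟦ isV (i ∷ j ∷ positions l β) ⟧ ≈ ⟦ suc i <ᵇ j ⟧ * noRise β
  isV-∷∷ i j l []          = sym (*-identityʳ _)
  isV-∷∷ i j l (true ∷ β)  = sym (zeroʳ _)
  isV-∷∷ i j l (false ∷ β) = isV-∷∷ i j (suc l) β

  -- Once the position `suc i` has been passed, every later rise is too far from `i`.
  isU-far : ∀ {i j} β → suc i < j → ⟦ isU (i ∷ positions j β) ⟧ ≈ 0#
  isU-far []          h = refl
  isU-far {i} {j} (true ∷ β)  h = trans (isU-∷∷ i j (suc j) β) (trans (*-congʳ (reflexive (cong ⟦_⟧ (<⇒≢ᵇ h)))) (zeroˡ _))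
  isU-far (false ∷ β) h = isU-far β (ℕ.m≤n⇒m≤1+n h)

  isU≈twoAdjacent : ∀ i β → ⟦ isU (positions i β) ⟧ ≈ twoAdjacent β
  isU≈twoAdjacent i []                 = refl
  isU≈twoAdjacent i (false ∷ β)        = isU≈twoAdjacent (suc i) β
  isU≈twoAdjacent i (true ∷ [])        = refl
  isU≈twoAdjacent i (true ∷ true ∷ β)  = trans (isU-∷∷ i (suc i) (2 ℕ.+ i) β)
    (trans (*-congʳ (reflexive (cong ⟦_⟧ (≡ᵇ-refl i)))) (*-identityˡ _))
  isU≈twoAdjacent i (true ∷ false ∷ β) = isU-far β ℕ.≤-refl

  adjacent-or-far : ∀ {i j} → i < j → ⟦ j ≡ᵇ suc i ⟧ + ⟦ suc i <ᵇ j ⟧ ≈ 1#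
  adjacent-or-far {zero}  {suc zero}    h       = +-identityʳ _
  adjacent-or-far {zero}  {suc (suc j)} h       = +-identityˡ _
  adjacent-or-far {suc i} {suc j}       (s≤s h) = adjacent-or-far h

  isU+isV-∷ : ∀ {i j} β → i < j → ⟦ isU (i ∷ positions j β) ⟧ + ⟦ isV (i ∷ positions j β) ⟧ ≈ oneRise β
  isU+isV-∷ []          h = +-identityˡ _
  isU+isV-∷ {i} {j} (true ∷ β) h = trans (+-cong (isU-∷∷ i j (suc j) β) (isV-∷∷ i j (suc j) β))
    (trans (sym (distribʳ _ _ _)) (trans (*-congʳ (adjacent-or-far h)) (*-identityˡ _)))
  isU+isV-∷ (false ∷ β) h = isU+isV-∷ β (ℕ.m≤n⇒m≤1+n h)

  isU+isV≈twoRises : ∀ i β → ⟦ isU (positions i β) ⟧ + ⟦ isV (positions i β) ⟧ ≈ twoRises β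
  isU+isV≈twoRises i []          = +-identityˡ _
  isU+isV≈twoRises i (true ∷ β)  = isU+isV-∷ β ℕ.≤-refl
  isU+isV≈twoRises i (false ∷ β) = isU+isV≈twoRises (suc i) β

  ^'-cong : ∀ n {x y} → x ≈ y → x ^' n ≈ y ^' n
  ^'-cong zero    h = refl
  ^'-cong (suc n) h = *-cong h (^'-cong n h)

  kInt-cong : ∀ k {x y} → x ≈ y → kInt k x ≈ kInt k y
  kInt-cong k h = sumBelow-cong k λ i → ^'-cong i h

  -- Recursions for the generating functions, and both formulas.

  module GeneratingFunctions (k : ℕ) (p q r : Carrier) (invFact : ℕ → Carrier)
                             (invFact-inverse : ∀ n → invFact n * pqFact p q n ≈ 1#) where

    open GF k p q r invFact

    riseSeries : (List Bool → Carrier) → Series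
    riseSeries Φ n = invFact n * riseSum k p q r n Φ

    riseSeries-cong : ∀ {Φ Ψ} → (∀ β → Φ β ≈ Ψ β) → riseSeries Φ ≋ riseSeries Ψ
    riseSeries-cong h n = *-congˡ (sumList-cong (λ _ → *-congˡ (h _)) (wreath n k))

    riseSeries-+ : ∀ Φ Ψ → riseSeries (λ β → Φ β + Ψ β) ≋ riseSeries Φ ⊕ riseSeries Ψ
    riseSeries-+ Φ Ψ n = trans (*-congˡ (trans (sumList-cong (λ _ → distribˡ _ _ _) (wreath n k))
      (sumList-+ _ _ (wreath n k)))) (distribˡ _ _ _)

    riseSeries-* : ∀ a Φ n → riseSeries (λ β → a * Φ β) n ≈ a * riseSeries Φ n
    riseSeries-* a Φ n = trans (*-congˡ (trans
      (sumList-cong (λ _ → solve 3 (λ x y z → x :* (y :* z) := y :* (x :* z)) refl _ _ _) (wreath n k))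
      (sumList-*ˡ a _ (wreath n k))))
      (solve 3 (λ x y z → x :* (y :* z) := y :* (x :* z)) refl _ _ _)

    riseSeries-0 : ∀ n → riseSeries (λ _ → 0#) n ≈ 0#
    riseSeries-0 n = trans (*-congˡ (trans (sumList-cong (λ _ → zeroʳ _) (wreath n k)) (sumList-0 (wreath n k)))) (zeroʳ _)

    riseSeries-zero : ∀ Φ → riseSeries Φ 0 ≈ Φ []
    riseSeries-zero Φ = trans (*-cong (trans (sym (*-identityʳ _)) (invFact-inverse 0))
      (solve 1 (λ x → (con 1 :* con 1 :* con 1) :* x :+ con 0 := x) refl _)) (*-identityˡ _)

    -- Division of `chains-pqFact` by three factorials: the factors `invFact * pqFact` at `l` and
    -- `m` are inserted as 1, and the one at `l + m` is removed as 1.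
    invFact-chains : ∀ l m → invFact (l ℕ.+ m) * chains p q l m 0 ≈ (p ^' (l C 2)) * (invFact l * invFact m)
    invFact-chains l m = begin
      invFact (l ℕ.+ m) * chains p q l m 0
        ≈⟨ trans (*-identityʳ _) (*-identityʳ _) ⟨
      (invFact (l ℕ.+ m) * chains p q l m 0) * 1# * 1#
        ≈⟨ *-cong (*-congˡ (invFact-inverse l)) (invFact-inverse m) ⟨
      (invFact (l ℕ.+ m) * chains p q l m 0) * (invFact l * pqFact p q l) * (invFact m * pqFact p q m)
        ≈⟨ solve 6 (λ a b c d e f → (a :* b) :* (c :* d) :* (e :* f) := (b :* (d :* f)) :* (a :* (c :* e))) refl _ _ _ _ _ _ ⟩
      (chains p q l m 0 * (pqFact p q l * pqFact p q m)) * (invFact (l ℕ.+ m) * (invFact l * invFact m))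
        ≈⟨ *-congʳ (chains-pqFact p q l m) ⟩
      ((p ^' (l C 2)) * pqFact p q (l ℕ.+ m)) * (invFact (l ℕ.+ m) * (invFact l * invFact m))
        ≈⟨ solve 4 (λ a b c d → (a :* b) :* (c :* d) := (a :* d) :* (c :* b)) refl _ _ _ _ ⟩
      ((p ^' (l C 2)) * (invFact l * invFact m)) * (invFact (l ℕ.+ m) * pqFact p q (l ℕ.+ m))
        ≈⟨ trans (*-congˡ (invFact-inverse (l ℕ.+ m))) (*-identityʳ _) ⟩
      (p ^' (l C 2)) * (invFact l * invFact m) ∎

    -- The coefficients of P, G and H up to sign and integer factor.
    base : Series
    base n = (p ^' (n C 2)) * invFact n * kInt k (r ^' n)

    base*riseSeries : ∀ l m Φ → base (suc l) * riseSeries Φ m ≈ riseSeries (block (suc l) Φ) (suc (l ℕ.+ m))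
    base*riseSeries l m Φ = begin
      base (suc l) * riseSeries Φ m
        ≈⟨ solve 5 (λ a b c d e → (a :* b :* c) :* (d :* e) := (a :* (b :* d)) :* (c :* e)) refl _ _ _ _ _ ⟩
      ((p ^' (suc l C 2)) * (invFact (suc l) * invFact m)) * (kInt k (r ^' suc l) * riseSum k p q r m Φ)
        ≈⟨ *-congʳ (invFact-chains (suc l) m) ⟨
      (invFact (suc l ℕ.+ m) * chains p q (suc l) m 0) * (kInt k (r ^' suc l) * riseSum k p q r m Φ)
        ≈⟨ solve 4 (λ a b c d → (a :* b) :* (c :* d) := a :* ((c :* b) :* d)) refl _ _ _ _ ⟩
      invFact (suc l ℕ.+ m) * ((kInt k (r ^' suc l) * chains p q (suc l) m 0) * riseSum k p q r m Φ)
        ≈⟨ *-congˡ (riseSum-block k p q r l m Φ) ⟨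
      riseSeries (block (suc l) Φ) (suc (l ℕ.+ m)) ∎

    -- `S 0` is the coefficient of the empty block, which leaves the pattern untouched.
    prepend : Series → (ℕ → Carrier) → (List Bool → Carrier) → List Bool → Carrier
    prepend S y Φ β = S 0 * Φ β + blocks y Φ β

    -- Only positive degrees are covered: `[]` is the pattern of the empty word as well as of a
    -- single letter, so in degree 0 `prepend` would also count a one-letter block, which does not
    -- fit. Degree 0 is computed directly by `⊛-riseSeries-zero`.
    ⊛-riseSeries : ∀ {S y} → (∀ i → S (suc i) ≈ y i * base (suc i)) → ∀ Φ n →
      (S ⊛ riseSeries Φ) (suc n) ≈ riseSeries (prepend S y Φ) (suc n)
    ⊛-riseSeries {S} {y} hS Φ n = begin
      (S ⊛ riseSeries Φ) (suc n)
        ≈⟨ ⊛-front S (riseSeries Φ) n ⟩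
      S 0 * riseSeries Φ (suc n) + sumBelow (suc n) (λ i → S (suc i) * riseSeries Φ (n ∸ i))
        ≈⟨ +-cong (sym (riseSeries-* (S 0) Φ (suc n))) (trans (sumBelow-cong< (suc n) λ { i (s≤s i≤n) → term i i≤n })
             (trans (sumBelow-*ˡ (suc n) _ _) (*-congˡ (sym (riseSum-blocks k p q r n y Φ))))) ⟩
      riseSeries (λ β → S 0 * Φ β) (suc n) + riseSeries (blocks y Φ) (suc n)
        ≈⟨ riseSeries-+ (λ β → S 0 * Φ β) (blocks y Φ) (suc n) ⟨
      riseSeries (prepend S y Φ) (suc n) ∎
      where
      term : ∀ i → i ≤ n → S (suc i) * riseSeries Φ (n ∸ i) ≈
        invFact (suc n) * (y i * riseSum k p q r (suc n) (block (suc i) Φ))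
      term i i≤n = begin
        S (suc i) * riseSeries Φ (n ∸ i)
          ≈⟨ trans (*-congʳ (hS i)) (*-assoc _ _ _) ⟩
        y i * (base (suc i) * riseSeries Φ (n ∸ i))
          ≈⟨ *-congˡ (base*riseSeries i (n ∸ i) Φ) ⟩
        y i * riseSeries (block (suc i) Φ) (suc (i ℕ.+ (n ∸ i)))
          ≡⟨ cong (λ m → y i * riseSeries (block (suc i) Φ) (suc m)) (ℕ.m+[n∸m]≡n i≤n) ⟩
        y i * riseSeries (block (suc i) Φ) (suc n)
          ≈⟨ solve 3 (λ a b c → a :* (b :* c) := b :* (a :* c)) refl _ _ _ ⟩
        invFact (suc n) * (y i * riseSum k p q r (suc n) (block (suc i) Φ)) ∎

    ⊛-riseSeries-zero : ∀ S Φ → (S ⊛ riseSeries Φ) 0 ≈ S 0 * Φ []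
    ⊛-riseSeries-zero S Φ = trans (+-identityˡ _) (*-congˡ (riseSeries-zero Φ))

    Q : Series
    Q = L ⊕ P ⊖ G

    e-base : ∀ i → e (suc i) ≈ sign i * base (suc i)
    e-base i = solve 4 (λ a b c d → a :* b :* c :* d := b :* (a :* c :* d)) refl _ _ _ _

    G-base : ∀ i → G (suc i) ≈ signG i * base (suc i)
    G-base i = trans (natMul-cong i (e-base i)) (natMul-* i _ _)

    H-base : ∀ i → H (suc i) ≈ signH i * base (suc i)
    H-base i = trans (-‿cong (trans (natMul-cong (i C 2) (e-base i)) (natMul-* (i C 2) _ _))) (-‿distribˡ-* _ _)

    invFact1 : invFact 1 ≈ 1#
    invFact1 = trans (sym (*-identityʳ _)) (trans (*-congˡ (sym
      (solve 0 ((con 0 :+ con 1 :* con 1) :* con 1 := con 1) refl))) (invFact-inverse 1))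

    e1 : e 1 ≈ - kInt k r
    e1 = begin
      1# * (- 1# * 1#) * invFact 1 * kInt k (r * 1#)
        ≈⟨ *-cong (*-cong (trans (*-identityˡ _) (*-identityʳ _)) invFact1) (kInt-cong k (*-identityʳ r)) ⟩
      - 1# * 1# * kInt k r
        ≈⟨ *-congʳ (*-identityʳ _) ⟩
      - 1# * kInt k r
        ≈⟨ -1*x≈-x _ ⟩
      - kInt k r ∎

    x-0≈x : ∀ x → x - 0# ≈ x
    x-0≈x x = trans (+-congˡ -0#≈0#) (+-identityʳ x)

    -- The term [k]_r t is exactly what removes the linear coefficient -[k]_r of P. In degree n =
    -- i+2 of P - G the integer factor is 1 - (n-1) = -i.
    Q-base : ∀ i → Q (suc i) ≈ signQ i * base (suc i)
    Q-base zero    = trans (x-0≈x _) (trans (+-congˡ e1) (trans (-‿inverseʳ _) (sym (zeroˡ _))))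
    Q-base (suc i) = begin
      (0# + e (2 ℕ.+ i)) - (e (2 ℕ.+ i) + natMul i (e (2 ℕ.+ i)))
        ≈⟨ +-cong (+-identityˡ _) (sym (-‿+-comm _ _)) ⟩
      e (2 ℕ.+ i) + (- e (2 ℕ.+ i) + - natMul i (e (2 ℕ.+ i)))
        ≈⟨ trans (sym (+-assoc _ _ _)) (trans (+-congʳ (-‿inverseʳ _)) (+-identityˡ _)) ⟩
      - natMul i (e (2 ℕ.+ i))
        ≈⟨ -‿cong (trans (natMul-cong i (e-base (suc i))) (natMul-* i _ _)) ⟩
      - (natMul i (sign (suc i)) * base (2 ℕ.+ i))
        ≈⟨ -‿distribˡ-* _ _ ⟩
      signQ (suc i) * base (2 ℕ.+ i) ∎

    prepend-P : ∀ Φ β → prepend P sign Φ β ≈ Φ β + blocks sign Φ β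
    prepend-P Φ β = +-congʳ (*-identityˡ _)

    prepend-0 : ∀ S y Φ β → S 0 ≈ 0# → prepend S y Φ β ≈ blocks y Φ β
    prepend-0 S y Φ β S0≈0 = trans (+-congʳ (trans (*-congʳ S0≈0) (zeroˡ _))) (+-identityˡ _)

    G0 : G 0 ≈ 0#
    G0 = refl

    H0 : H 0 ≈ 0#
    H0 = -0#≈0#

    Q0 : Q 0 ≈ 0#
    Q0 = trans (x-0≈x _) (-‿inverseˡ 1#)

    ⊛-riseSeries-zero-0 : ∀ S Φ → S 0 ≈ 0# → (S ⊛ riseSeries Φ) 0 ≈ 0#
    ⊛-riseSeries-zero-0 S Φ S0≈0 = trans (⊛-riseSeries-zero S Φ) (trans (*-congʳ S0≈0) (zeroˡ _))

    P⊛noRise : P ⊛ riseSeries noRise ≋ 1ₛ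
    P⊛noRise zero    = trans (⊛-riseSeries-zero P noRise) (*-identityˡ _)
    P⊛noRise (suc n) = begin
      (P ⊛ riseSeries noRise) (suc n)
        ≈⟨ ⊛-riseSeries {P} e-base noRise n ⟩
      riseSeries (prepend P sign noRise) (suc n)
        ≈⟨ riseSeries-cong (λ β → trans (prepend-P noRise β) (noRise-blocks β)) (suc n) ⟩
      riseSeries (λ _ → 0#) (suc n)
        ≈⟨ riseSeries-0 (suc n) ⟩
      0# ∎

    P⊛oneRise : P ⊛ riseSeries oneRise ≋ G ⊛ riseSeries noRise
    P⊛oneRise zero    = trans (⊛-riseSeries-zero P oneRise) (trans (zeroʳ _) (sym (⊛-riseSeries-zero-0 G noRise G0)))
    P⊛oneRise (suc n) = begin
      (P ⊛ riseSeries oneRise) (suc n)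
        ≈⟨ ⊛-riseSeries {P} e-base oneRise n ⟩
      riseSeries (prepend P sign oneRise) (suc n)
        ≈⟨ riseSeries-cong (λ β → trans (prepend-P oneRise β)
             (trans (oneRise-blocks β) (sym (prepend-0 G signG noRise β G0)))) (suc n) ⟩
      riseSeries (prepend G signG noRise) (suc n)
        ≈⟨ ⊛-riseSeries {G} G-base noRise n ⟨
      (G ⊛ riseSeries noRise) (suc n) ∎

    P⊛twoRises : P ⊛ riseSeries twoRises ≋ G ⊛ riseSeries oneRise ⊕ H ⊛ riseSeries noRise
    P⊛twoRises zero    = trans (⊛-riseSeries-zero P twoRises) (trans (zeroʳ _) (sym (trans
      (+-cong (⊛-riseSeries-zero-0 G oneRise G0) (⊛-riseSeries-zero-0 H noRise H0)) (+-identityˡ _))))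
    P⊛twoRises (suc n) = begin
      (P ⊛ riseSeries twoRises) (suc n)
        ≈⟨ ⊛-riseSeries {P} e-base twoRises n ⟩
      riseSeries (prepend P sign twoRises) (suc n)
        ≈⟨ riseSeries-cong (λ β → trans (prepend-P twoRises β) (trans (twoRises-blocks β)
             (sym (+-cong (prepend-0 G signG oneRise β G0) (prepend-0 H signH noRise β H0))))) (suc n) ⟩
      riseSeries (λ β → prepend G signG oneRise β + prepend H signH noRise β) (suc n)
        ≈⟨ riseSeries-+ (prepend G signG oneRise) (prepend H signH noRise) (suc n) ⟩
      riseSeries (prepend G signG oneRise) (suc n) + riseSeries (prepend H signH noRise) (suc n)
        ≈⟨ +-cong (⊛-riseSeries {G} G-base oneRise n) (⊛-riseSeries {H} H-base noRise n) ⟨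
      (G ⊛ riseSeries oneRise ⊕ H ⊛ riseSeries noRise) (suc n) ∎

    P⊛twoAdjacent : P ⊛ riseSeries twoAdjacent ≋ Q ⊛ riseSeries noRise
    P⊛twoAdjacent zero    = trans (⊛-riseSeries-zero P twoAdjacent)
      (trans (zeroʳ _) (sym (⊛-riseSeries-zero-0 Q noRise Q0)))
    P⊛twoAdjacent (suc n) = begin
      (P ⊛ riseSeries twoAdjacent) (suc n)
        ≈⟨ ⊛-riseSeries {P} e-base twoAdjacent n ⟩
      riseSeries (prepend P sign twoAdjacent) (suc n)
        ≈⟨ riseSeries-cong (λ β → trans (prepend-P twoAdjacent β)
             (trans (twoAdjacent-blocks β) (sym (prepend-0 Q signQ noRise β Q0)))) (suc n) ⟩
      riseSeries (prepend Q signQ noRise) (suc n)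
        ≈⟨ ⊛-riseSeries {Q} Q-base noRise n ⟨
      (Q ⊛ riseSeries noRise) (suc n) ∎

    filtered≈riseSeries : ∀ (B : List ℕ → Bool) n →
      invFact n * weightSum p q r (filterᵇ (λ x → B (WRis x)) (wreath n k)) ≈
      riseSeries (λ β → ⟦ B (positions 1 β) ⟧) n
    filtered≈riseSeries B n = *-congˡ (trans (weightSum-filterᵇ k p q r _ (wreath n k))
      (sumList-cong (λ (σ , w) → *-congˡ (reflexive (cong (λ ps → ⟦ B ps ⟧) (wrisFrom≡positions 1 σ w)))) (wreath n k)))

    AU≋ : AU ≋ riseSeries twoAdjacent
    AU≋ n = trans (filtered≈riseSeries isU n) (riseSeries-cong (isU≈twoAdjacent 1) n)

    AU⊕AV≋ : AU ⊕ AV ≋ riseSeries twoRises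
    AU⊕AV≋ n = trans (+-cong (filtered≈riseSeries isU n) (filtered≈riseSeries isV n))
      (trans (sym (riseSeries-+ (λ β → ⟦ isU (positions 1 β) ⟧) (λ β → ⟦ isV (positions 1 β) ⟧) n))
             (riseSeries-cong (isU+isV≈twoRises 1) n))

    P⊛AU : P ⊛ AU ≋ Q ⊛ riseSeries noRise
    P⊛AU n = trans (⊛-cong {P} (λ _ → refl) AU≋ n) (P⊛twoAdjacent n)

    -- The bracket in the second formula is H - Q; this is the form in which `solve-for-v` takes it.
    H≋ : H ≋ (H ⊕ G ⊖ L ⊖ P) ⊕ Q
    H≋ n = sym (begin
      (((H n + G n) - L n) - P n) + ((L n + P n) - G n)
        -- The semiring solver has no negation, so `- L n`, `- P n` and `- G n` are passed as
        -- independent atoms.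
        ≈⟨ solve 7 (λ h g l p l′ p′ g′ → (((h :+ g) :+ l′) :+ p′) :+ ((l :+ p) :+ g′) :=
             h :+ ((g :+ g′) :+ ((l :+ l′) :+ (p :+ p′)))) refl (H n) (G n) (L n) (P n) (- L n) (- P n) (- G n) ⟩
      H n + ((G n - G n) + ((L n - L n) + (P n - P n)))
        ≈⟨ +-congˡ (+-cong (-‿inverseʳ _) (+-cong (-‿inverseʳ _) (-‿inverseʳ _))) ⟩
      H n + (0# + (0# + 0#))
        ≈⟨ trans (+-congˡ (trans (+-identityˡ _) (+-identityˡ _))) (+-identityʳ _) ⟩
      H n ∎)

theorem16 : ∀ {c ℓ : Level} (R : CommutativeRing c ℓ) →
    let open CommutativeRing R
        open WithRing R
    in (k : ℕ) → 2 ≤ k → (p q r : Carrier) → (invFact : ℕ → Carrier) →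
       (∀ n → invFact n * pqFact p q n ≈ 1#) →
       let open GF k p q r invFact
       in (AU ⊛ P ⊛ P ≋ L ⊕ P ⊖ G)
          × (AV ⊛ P ⊛ P ⊛ P ≋ G ⊛ G ⊕ P ⊛ (H ⊕ G ⊖ L ⊖ P))
theorem16 R k _ p q r invFact invFact-inverse =
  solve-for-u P Q AU (riseSeries noRise) P⊛noRise P⊛AU ,
  solve-for-v P Q G H (H ⊕ G ⊖ L ⊖ P) AU AV (riseSeries noRise) (riseSeries oneRise) (riseSeries twoRises)
    P⊛noRise P⊛oneRise P⊛twoRises P⊛AU AU⊕AV≋ H≋
  where
  open WithRing R
  open GF k p q r invFact
  open RiseSeries R
  open GeneratingFunctions k p q r invFact invFact-inverse
  open Quotients seriesRing
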